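{- For every integer $n\ge 1$, the reduced (integral) homology of the clique complex $K_n$ of the partition graph $G_n$ is concentrated in degree $2$, and $\widetilde H_2(K_n)\cong\mathbb Z^{\,\chi(K_n)-1}$. Equivalently, $\widetilde H_i(K_n)=0$ for $i\ne 2$ and $\operatorname{rank}\widetilde H_2(K_n)=\chi(K_n)-1$, where $\chi$ denotes the Euler characteristic.
   Context: A partition of a positive integer $n$ is a weakly decreasing sequence $\lambda=(\lambda_1\ge\cdots\ge\lambda_\ell>0)$ of positive integers with sum $n$; it is identified with its Ferrers diagram, the left-justified array with $\lambda_i$ cells in row $i$. The partition graph $G_n$ is the simple graph whose vertices are all partitions of $n$; two distinct partitions are adjacent if one can be obtained from the other by removing one cell from a row of the Ferrers diagram, adding it to another row (possibly a new row, i.e. a row of length $0$), and then reordering the row lengths into weakly decreasing order (discarding zeros). $K_n:=\mathrm{Cl}(G_n)$ is the clique complex of $G_n$: the simplicial complex whose simplices are the finite nonempty cliques of $G_n$. -}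

module Defs where

open import Algebra.Bundles using (AbelianGroup)
open import Algebra.Construct.Pointwise as Pointwise using ()
open import Algebra.Construct.Terminal as Terminal using ()
open import Algebra.Morphism.Bundles using (GroupHomomorphism)
open import Algebra.Morphism.Construct.Terminal as TerminalMorphism using (isGroupHomomorphism)
open import Algebra.Morphism.Structures using (IsGroupIsomorphism)
open import Algebra.Properties.AbelianGroup as AbelianGroupProperties using ()
open import Algebra.Properties.CommutativeSemigroup as CommutativeSemigroupProperties using ()
open import Data.Bool.Base using (if_then_else_)
open import Data.Fin.Base using (Fin; toℕ)
open import Data.Fin.Properties as Fin using ()
open import Data.Integer.Base as ℤ using (ℤ; +_; -[1+_]; 0ℤ; -1ℤ)
open import Data.Integer.Properties as ℤ using ()
open import Data.List.Base
  using (List; []; _∷_; [_]; _++_; map; filter; concatMap; mapMaybe; deduplicate; length; lookup; removeAt)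
open import Data.List.Membership.Propositional using (_∈_; lose)
open import Data.List.Membership.Propositional.Properties using (∈-∃++; ∈-concatMap⁺; ∈-deduplicate⁺)
open import Data.List.Properties using (≡-dec)
open import Data.List.Relation.Binary.Permutation.Propositional
  using (_↭_; ↭-refl; ↭-prep; ↭-sym; ↭-trans; ↭⇒↭ₛ)
open import Data.List.Relation.Binary.Permutation.Propositional.Properties
  using (shift; drop-∷; ∈-resp-↭; ¬x∷xs↭[])
open import Data.List.Relation.Binary.Permutation.Setoid.Properties using (AllPairs-resp-↭)
open import Data.List.Relation.Binary.Sublist.Propositional using (_⊆_; []; _∷_; _∷ʳ_)
open import Data.List.Relation.Binary.Sublist.Propositional.Properties using (All-resp-⊆)
open import Data.List.Relation.Unary.All as All using (All; []; _∷_)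
open import Data.List.Relation.Unary.AllPairs as AllPairs using (AllPairs; []; _∷_; allPairs?)
open import Data.List.Relation.Unary.Any as Any using (here; there)
open import Data.List.Relation.Unary.Any.Properties as Any using ()
open import Data.List.Relation.Unary.Linked as Linked using (Linked; linked?)
open import Data.List.Relation.Unary.Unique.DecPropositional.Properties using (deduplicate-!)
open import Data.List.Relation.Unary.Unique.Propositional using (Unique)
open import Data.Maybe.Base using (Maybe; just; nothing)
open import Data.Maybe.Relation.Unary.Any as MaybeAny using ()
open import Data.Nat.Base using (ℕ; zero; suc; pred; _≥_; _<_; z≤n; s≤s)
open import Data.Nat.ListAction using (sum)
open import Data.Nat.Properties as ℕ using (_≥?_; _<?_)
open import Data.Product.Base using (Σ-syntax; ∃-syntax; _×_; _,_)
open import Data.Sum.Base using (_⊎_; swap)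
open import Data.Vec.Base as Vec using ()
open import Function.Base using (_∘_)
open import Level using (0ℓ)
open import Relation.Binary.Definitions using (DecidableEquality; Decidable; Symmetric; Irreflexive)
open import Relation.Binary.PropositionalEquality
  using (_≡_; _≢_; refl; sym; trans; cong; subst; setoid; ≢-sym; resp₂)
open import Relation.Nullary.Decidable
  using (yes; no; does; map′; _×-dec_; _⊎-dec_; ¬?)
open import Relation.Nullary.Negation using (contradiction)
open import Relation.Unary as Unary using ()

open import Algebra.Properties.CommutativeMonoid.Sum ℤ.+-0-commutativeMonoid
  using (sum-syntax; sum-cong-≗; ∑-distrib-+)

------------------------------------------------------------------------
-- Abelian groups

AbGroup : Set₁
AbGroup = AbelianGroup 0ℓ 0ℓ

infixr 4 _⟶_
infix  4 _≅_
infix  9 ℤ^_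

_⟶_ : AbGroup → AbGroup → Set
A ⟶ B = GroupHomomorphism (AbelianGroup.rawGroup A) (AbelianGroup.rawGroup B)

_≅_ : AbGroup → AbGroup → Set
A ≅ B = Σ[ f ∈ (Carrier A → Carrier B) ] IsGroupIsomorphism (rawGroup A) (rawGroup B) f
  where open AbelianGroup

IsTrivial : AbGroup → Set
IsTrivial A = ∀ x → x ≈ ε
  where open AbelianGroup A

𝟘 : AbGroup
𝟘 = Terminal.abelianGroup

⟶𝟘 : {A : AbGroup} → A ⟶ 𝟘
⟶𝟘 {A} = record
  { isGroupHomomorphism = TerminalMorphism.isGroupHomomorphism (AbelianGroup.rawGroup A) }

ℤ^_ : ℕ → AbGroup
ℤ^ r = Pointwise.abelianGroup (Fin r) ℤ.+-0-abelianGroup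

module _ (A B : AbGroup) where

  private
    module A = AbelianGroup A
    module B = AbelianGroup B
    open AbelianGroupProperties B using (identityˡ-unique; inverseˡ-unique)

  additive⇒⟶ : (f : A.Carrier → B.Carrier) →
               (∀ {x y} → x A.≈ y → f x B.≈ f y) →
               (∀ x y → f (x A.∙ y) B.≈ f x B.∙ f y) →
               A ⟶ B
  additive⇒⟶ f f-cong f-+ = record
    { ⟦_⟧ = f
    ; isGroupHomomorphism = record
      { isMonoidHomomorphism = record
        { isMagmaHomomorphism = record
          { isRelHomomorphism = record { cong = f-cong }
          ; homo = f-+
          }
        ; ε-homo = f-ε
        }
      ; ⁻¹-homo = λ x → inverseˡ-unique (f (x A.⁻¹)) (f x)
          (B.trans (B.sym (f-+ (x A.⁻¹) x)) (B.trans (f-cong (A.inverseˡ x)) f-ε))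
      }
    }
    where
    f-ε : f A.ε B.≈ B.ε
    f-ε = identityˡ-unique (f A.ε) (f A.ε)
      (B.trans (B.sym (f-+ A.ε A.ε)) (f-cong (A.identityˡ A.ε)))

-- Quotients are setoids here: the elements of  ker e / im d  are those of
-- ker e, and two of them are equal when their difference lies in im d.

module _ {A B C : AbGroup} (d : A ⟶ B) (e : B ⟶ C) where

  private
    module A = AbelianGroup A
    module B = AbelianGroup B
    module C = AbelianGroup C
    module d = GroupHomomorphism d
    module e = GroupHomomorphism e
    open AbelianGroupProperties B using (⁻¹-∙-comm; ⁻¹-involutive)
    open AbelianGroupProperties C using (ε⁻¹≈ε)
    open CommutativeSemigroupProperties B.commutativeSemigroup using (interchange)
    open import Relation.Binary.Reasoning.Setoid B.setoid

  Cycle : Set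
  Cycle = Σ[ x ∈ B.Carrier ] e.⟦ x ⟧ C.≈ C.ε

  IsBoundary : B.Carrier → Set
  IsBoundary x = ∃[ a ] d.⟦ a ⟧ B.≈ x

  private
    IsBoundary-resp : ∀ {x y} → x B.≈ y → IsBoundary x → IsBoundary y
    IsBoundary-resp x≈y (a , da≈x) = a , B.trans da≈x x≈y

    IsBoundary-∙ : ∀ {x y} → IsBoundary x → IsBoundary y → IsBoundary (x B.∙ y)
    IsBoundary-∙ (a , da≈x) (b , db≈y) =
      a A.∙ b , B.trans (d.homo a b) (B.∙-cong da≈x db≈y)

    IsBoundary-⁻¹ : ∀ {x} → IsBoundary x → IsBoundary (x B.⁻¹)
    IsBoundary-⁻¹ (a , da≈x) = a A.⁻¹ , B.trans (d.⁻¹-homo a) (B.⁻¹-cong da≈x)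

    ≈⇒IsBoundary : ∀ {x y} → x B.≈ y → IsBoundary (x B.- y)
    ≈⇒IsBoundary {x} {y} x≈y =
      A.ε , B.trans d.ε-homo (B.sym (B.trans (B.∙-congʳ x≈y) (B.inverseʳ y)))

    minus-⁻¹ : ∀ x y → (x B.- y) B.⁻¹ B.≈ x B.⁻¹ B.- y B.⁻¹
    minus-⁻¹ x y = B.sym (⁻¹-∙-comm x (y B.⁻¹))

    flip-minus : ∀ x y → (x B.- y) B.⁻¹ B.≈ y B.- x
    flip-minus x y = begin
      (x B.- y) B.⁻¹            ≈⟨ minus-⁻¹ x y ⟩
      x B.⁻¹ B.∙ y B.⁻¹ B.⁻¹    ≈⟨ B.∙-congˡ (⁻¹-involutive y) ⟩
      x B.⁻¹ B.∙ y              ≈⟨ B.comm _ _ ⟩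
      y B.- x                   ∎

    telescope : ∀ x y z → (x B.- y) B.∙ (y B.- z) B.≈ x B.- z
    telescope x y z = begin
      (x B.∙ y B.⁻¹) B.∙ (y B.∙ z B.⁻¹)  ≈⟨ B.assoc _ _ _ ⟩
      x B.∙ (y B.⁻¹ B.∙ (y B.∙ z B.⁻¹))  ≈⟨ B.∙-congˡ (B.sym (B.assoc _ _ _)) ⟩
      x B.∙ ((y B.⁻¹ B.∙ y) B.∙ z B.⁻¹)  ≈⟨ B.∙-congˡ (B.∙-congʳ (B.inverseˡ y)) ⟩
      x B.∙ (B.ε B.∙ z B.⁻¹)             ≈⟨ B.∙-congˡ (B.identityˡ _) ⟩
      x B.- z                            ∎

    minus-∙ : ∀ x y u v → (x B.- y) B.∙ (u B.- v) B.≈ (x B.∙ u) B.- (y B.∙ v)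
    minus-∙ x y u v =
      B.trans (interchange x (y B.⁻¹) u (v B.⁻¹)) (B.∙-congˡ (⁻¹-∙-comm y v))

  homology : AbGroup
  homology = record
    { Carrier = Cycle
    ; _≈_ = λ (x , _) (y , _) → IsBoundary (x B.- y)
    ; _∙_ = λ (x , ex) (y , ey) →
        x B.∙ y , C.trans (e.homo x y) (C.trans (C.∙-cong ex ey) (C.identityˡ C.ε))
    ; ε = B.ε , e.ε-homo
    ; _⁻¹ = λ (x , ex) →
        x B.⁻¹ , C.trans (e.⁻¹-homo x) (C.trans (C.⁻¹-cong ex) ε⁻¹≈ε)
    ; isAbelianGroup = record
      { isGroup = record
        { isMonoid = record
          { isSemigroup = record
            { isMagma = record
              { isEquivalence = record
                { refl = ≈⇒IsBoundary B.refl
                ; sym = IsBoundary-resp (flip-minus _ _) ∘ IsBoundary-⁻¹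
                ; trans = λ p q → IsBoundary-resp (telescope _ _ _) (IsBoundary-∙ p q)
                }
              ; ∙-cong = λ p q → IsBoundary-resp (minus-∙ _ _ _ _) (IsBoundary-∙ p q)
              }
            ; assoc = λ _ _ _ → ≈⇒IsBoundary (B.assoc _ _ _)
            }
          ; identity = (λ _ → ≈⇒IsBoundary (B.identityˡ _)) , (λ _ → ≈⇒IsBoundary (B.identityʳ _))
          }
        ; inverse = (λ _ → ≈⇒IsBoundary (B.inverseˡ _)) , (λ _ → ≈⇒IsBoundary (B.inverseʳ _))
        ; ⁻¹-cong = IsBoundary-resp (minus-⁻¹ _ _) ∘ IsBoundary-⁻¹
        }
      ; comm = λ _ _ → ≈⇒IsBoundary (B.comm _ _)
      }
    }

------------------------------------------------------------------------
-- Finite simplicial complexes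

-- A finite set of vertices is represented by a repetition-free list in any
-- order.  The faces are the simplices together with the empty set.

record FiniteSimplicialComplex : Set₁ where
  field
    Vertex            : Set
    _≟_               : DecidableEquality Vertex
    vertices          : List Vertex
    vertices-complete : ∀ v → v ∈ vertices
    vertices-unique   : Unique vertices

    IsFace  : List Vertex → Set
    isFace? : Unary.Decidable IsFace
    face-[]     : IsFace []
    face-[v]    : ∀ v → IsFace [ v ]
    face-unique : ∀ {σ} → IsFace σ → Unique σ
    face-↭      : ∀ {σ τ} → σ ↭ τ → IsFace σ → IsFace τ
    face-⊆      : ∀ {σ τ} → σ ⊆ τ → IsFace τ → IsFace σ

-- The sublists of xs of length k.
combinations : {A : Set} → ℕ → List A → List (List A)
combinations zero    xs       = [ [] ]
combinations (suc k) []       = []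
combinations (suc k) (x ∷ xs) = map (x ∷_) (combinations k xs) ++ combinations (suc k) xs

module _ (K : FiniteSimplicialComplex) where

  open FiniteSimplicialComplex K

  -- Every face with k vertices (so of dimension k - 1) occurs exactly once,
  -- oriented by the order of its vertices in the list of all vertices.
  faces : ℕ → List (List Vertex)
  faces k = filter isFace? (combinations k vertices)

  #faces : ℕ → ℕ
  #faces k = length (faces k)

  -- The simplicial chains of degree k - 1.
  Chains : ℕ → AbGroup
  Chains k = ℤ^ (#faces k)

  -- The coefficient of τ in  ∂ [v₀,…,vₖ] = ∑ᵢ (-1)ⁱ [v₀,…,v̂ᵢ,…,vₖ].
  incidence : List Vertex → List Vertex → ℤ
  incidence σ τ =
    ∑[ i < length σ ] (if does (≡-dec _≟_ (removeAt σ i) τ) then -1ℤ ℤ.^ toℕ i else 0ℤ)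

  boundary : ∀ k → (Fin (#faces (suc k)) → ℤ) → (Fin (#faces k) → ℤ)
  boundary k c τ =
    ∑[ σ < #faces (suc k) ] (c σ ℤ.* incidence (lookup (faces (suc k)) σ) (lookup (faces k) τ))

  ∂ : ∀ k → Chains (suc k) ⟶ Chains k
  ∂ k = additive⇒⟶ (Chains (suc k)) (Chains k) (boundary k)
    (λ c≗c′ τ → sum-cong-≗ (λ σ → cong (ℤ._* coeff σ τ) (c≗c′ σ)))
    (λ c c′ τ → trans
      (sum-cong-≗ (λ σ → ℤ.*-distribʳ-+ (coeff σ τ) (c σ) (c′ σ)))
      (∑-distrib-+ (λ σ → c σ ℤ.* coeff σ τ) (λ σ → c′ σ ℤ.* coeff σ τ)))
    where
    coeff : Fin (#faces (suc k)) → Fin (#faces k) → ℤ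
    coeff σ τ = incidence (lookup (faces (suc k)) σ) (lookup (faces k) τ)

  -- The homology of the augmented chain complex, whose term of degree -1 is
  -- spanned by the empty face and whose terms of lower degree vanish.
  H̃ : ℤ → AbGroup
  H̃ (+ i)        = homology {Chains (suc (suc i))} {Chains (suc i)} {Chains i} (∂ (suc i)) (∂ i)
  H̃ -[1+ zero  ] = homology {Chains 1} {Chains 0} {𝟘} (∂ 0) (⟶𝟘 {Chains 0})
  H̃ -[1+ suc _ ] = 𝟘

  -- No simplex has dimension ≥ length vertices.
  χ : ℤ
  χ = ∑[ i < length vertices ] (-1ℤ ℤ.^ toℕ i ℤ.* + #faces (suc (toℕ i)))

------------------------------------------------------------------------
-- Finite simple graphs and their clique complexes

record FiniteGraph : Set₁ where
  infix 4 _~_ _~?_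
  field
    Vertex            : Set
    _≟_               : DecidableEquality Vertex
    vertices          : List Vertex
    vertices-complete : ∀ v → v ∈ vertices
    vertices-unique   : Unique vertices

    _~_      : Vertex → Vertex → Set
    _~?_     : Decidable _~_
    ~-sym    : Symmetric _~_
    ~-irrefl : Irreflexive _≡_ _~_

private
  AllPairs-resp-⊆ : {A : Set} {R : A → A → Set} {xs ys : List A} →
                    xs ⊆ ys → AllPairs R ys → AllPairs R xs
  AllPairs-resp-⊆ []         []       = []
  AllPairs-resp-⊆ (_ ∷ʳ p)   (_ ∷ rs) = AllPairs-resp-⊆ p rs
  AllPairs-resp-⊆ (refl ∷ p) (r ∷ rs) = All-resp-⊆ p r ∷ AllPairs-resp-⊆ p rs

Cl : FiniteGraph → FiniteSimplicialComplex
Cl G = record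
  { Vertex            = Vertex
  ; _≟_               = _≟_
  ; vertices          = vertices
  ; vertices-complete = vertices-complete
  ; vertices-unique   = vertices-unique
  ; IsFace            = AllPairs _~_
  ; isFace?           = allPairs? _~?_
  ; face-[]           = []
  ; face-[v]          = λ _ → [] ∷ []
  ; face-unique       = AllPairs.map (λ u~v u≡v → ~-irrefl u≡v u~v)
  ; face-↭            = λ σ↭τ → AllPairs-resp-↭ (setoid Vertex) ~-sym (resp₂ _~_) (↭⇒↭ₛ σ↭τ)
  ; face-⊆            = AllPairs-resp-⊆
  }
  where open FiniteGraph G

------------------------------------------------------------------------
-- Partitions

record Partition (n : ℕ) : Set where
  constructor partition
  field
    parts      : List ℕ
    decreasing : Linked _≥_ parts
    positive   : All (0 <_) parts
    sum≡n      : sum parts ≡ n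

open Partition public using (parts)

parts-injective : ∀ {n} {λ₁ λ₂ : Partition n} → parts λ₁ ≡ parts λ₂ → λ₁ ≡ λ₂
parts-injective {λ₁ = partition ps d p s} {partition .ps d′ p′ s′} refl
  with Linked.irrelevant ℕ.≤-irrelevant d d′ | All.irrelevant ℕ.≤-irrelevant p p′ | ℕ.≡-irrelevant s s′
... | refl | refl | refl = refl

_≟ₚ_ : ∀ {n} → DecidableEquality (Partition n)
λ₁ ≟ₚ λ₂ = map′ parts-injective (cong parts) (≡-dec ℕ._≟_ (parts λ₁) (parts λ₂))

compositions : ℕ → List (List ℕ)
compositions zero    = [ [] ]
compositions (suc n) = concatMap extend (compositions n)
  where
  extend : List ℕ → List (List ℕ)
  extend []       = [ 1 ∷ [] ]
  extend (p ∷ ps) = (1 ∷ p ∷ ps) ∷ (suc p ∷ ps) ∷ []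

private
  ∈-compositions : ∀ n ps → All (0 <_) ps → sum ps ≡ n → ps ∈ compositions n
  ∈-compositions zero    []                 _       _  = here refl
  ∈-compositions zero    (zero ∷ _)         (() ∷ _)
  ∈-compositions zero    (suc _ ∷ _)        _       ()
  ∈-compositions (suc n) []                 _       ()
  ∈-compositions (suc n) (suc zero ∷ [])    (_ ∷ a) eq =
    ∈-concatMap⁺ _ (lose (∈-compositions n [] a (ℕ.suc-injective eq)) (here refl))
  ∈-compositions (suc n) (suc zero ∷ p ∷ ps) (_ ∷ a) eq =
    ∈-concatMap⁺ _ (lose (∈-compositions n (p ∷ ps) a (ℕ.suc-injective eq)) (here refl))
  ∈-compositions (suc n) (suc (suc p) ∷ ps) (_ ∷ a) eq =
    ∈-concatMap⁺ _ (lose (∈-compositions n (suc p ∷ ps) (s≤s z≤n ∷ a) (ℕ.suc-injective eq))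
                         (there (here refl)))

toPartition : ∀ n → List ℕ → Maybe (Partition n)
toPartition n ps with linked? _≥?_ ps ×-dec All.all? (0 <?_) ps ×-dec (sum ps ℕ.≟ n)
... | yes (d , p , s) = just (partition ps d p s)
... | no _            = nothing

partitions : ∀ n → List (Partition n)
partitions n = deduplicate _≟ₚ_ (mapMaybe (toPartition n) (compositions n))

private
  toPartition-parts : ∀ {n} (μ : Partition n) → toPartition n (parts μ) ≡ just μ
  toPartition-parts {n} (partition ps d p s)
    with linked? _≥?_ ps ×-dec All.all? (0 <?_) ps ×-dec (sum ps ℕ.≟ n)
  ... | yes _ = cong just (parts-injective refl)
  ... | no ¬q = contradiction (d , p , s) ¬q

partitions-complete : ∀ {n} (μ : Partition n) → μ ∈ partitions n
partitions-complete {n} μ = ∈-deduplicate⁺ _≟ₚ_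
  (Any.mapMaybe⁺ (toPartition n) (compositions n)
    (Any.map⁺ (Any.map step (∈-compositions n (parts μ) (Partition.positive μ) (Partition.sum≡n μ)))))
  where
  step : ∀ {ps} → parts μ ≡ ps → MaybeAny.Any (μ ≡_) (toPartition n ps)
  step refl = subst (MaybeAny.Any (μ ≡_)) (sym (toPartition-parts μ)) (MaybeAny.just refl)

partitions-unique : ∀ n → Unique (partitions n)
partitions-unique n = deduplicate-! _≟ₚ_ (mapMaybe (toPartition n) (compositions n))

------------------------------------------------------------------------
-- The partition graph

-- The row lengths of the diagram, and an empty row below it.
rows : ∀ {n} → Partition n → List ℕ
rows μ = parts μ ++ [ 0 ]

moveCell : (ls : List ℕ) → Fin (length ls) → Fin (length ls) → List ℕ
moveCell ls i j = Vec.toList (Vec.updateAt (Vec.updateAt (Vec.fromList ls) i pred) j suc)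

-- As the parts of ν are weakly decreasing, being a permutation of the
-- nonzero new row lengths determines ν.
Move : ∀ {n} → Partition n → Partition n → Set
Move μ ν = ∃[ i ] ∃[ j ]
  i ≢ j × 0 < lookup (rows μ) i × filter (0 <?_) (moveCell (rows μ) i j) ↭ parts ν

Adjacent : ∀ {n} → Partition n → Partition n → Set
Adjacent μ ν = μ ≢ ν × (Move μ ν ⊎ Move ν μ)

private
  _↭?_ : Decidable (_↭_ {A = ℕ})
  []       ↭? []       = yes ↭-refl
  []       ↭? (y ∷ ys) = no (¬x∷xs↭[] ∘ ↭-sym)
  (x ∷ xs) ↭? ys with Any.any? (x ℕ.≟_) ys
  ... | no x∉ys = no (λ p → x∉ys (∈-resp-↭ p (here refl)))
  ... | yes x∈ys with ∈-∃++ x∈ys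
  ...   | as , bs , refl = map′
    (λ p → ↭-trans (↭-prep x p) (↭-sym (shift x as bs)))
    (λ p → drop-∷ (↭-trans p (shift x as bs)))
    (xs ↭? (as ++ bs))

move? : ∀ {n} → Decidable (Move {n})
move? μ ν = Fin.any? (λ i → Fin.any? (λ j →
  ¬? (i Fin.≟ j) ×-dec (0 <? lookup (rows μ) i)
    ×-dec (filter (0 <?_) (moveCell (rows μ) i j) ↭? parts ν)))

adjacent? : ∀ {n} → Decidable (Adjacent {n})
adjacent? μ ν = ¬? (μ ≟ₚ ν) ×-dec (move? μ ν ⊎-dec move? ν μ)

G : ℕ → FiniteGraph
G n = record
  { Vertex            = Partition n
  ; _≟_               = _≟ₚ_
  ; vertices          = partitions n
  ; vertices-complete = partitions-complete
  ; vertices-unique   = partitions-unique n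
  ; _~_               = Adjacent
  ; _~?_              = adjacent?
  ; ~-sym             = λ (μ≢ν , m) → ≢-sym μ≢ν , swap m
  ; ~-irrefl          = λ μ≡ν (μ≢ν , _) → μ≢ν μ≡ν
  }

K : ℕ → FiniteSimplicialComplex
K n = Cl (G n)

{-# OPTIONS --safe #-}

-- Partitions are adjacent exactly when one diagram arises from the other by lowering some
-- column p and raising some column q ≠ p by one cell.  Give the partition (λ₁, λ₂, …) the
-- weight ∑ λᵢ(λᵢ + 1)/2, so that such a shift changes the weight by q - p, and build the
-- clique complex by adding the vertices in order of decreasing weight.  A new vertex l is
-- attached along the clique complex of its shifts (p , q) with p < q, of which there are
-- some unless l is the one-row partition, and two of which are adjacent exactly when they
-- share p or q.  When these are added by decreasing weight in turn, (p , q) is attached along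
-- two disjoint simplices, one on the (p′ , q) with p′ < p and one on the (p , q′) with q < q′;
-- they are not both empty unless (p , q) comes first.
--
-- If the reduced homology of a complex is free and concentrated in degree d, and that of
-- the link along which a new vertex is attached is free and concentrated in degree d - 1, then
-- the enlarged complex has free homology concentrated in degree d, and the ranks add up.
-- So the links of the links are concentrated in degree 0, the links in degree 1, and the
-- complex itself in degree 2; its Euler characteristic then determines the rank.

module Submission where

open import Defs
open import Algebra.Bundles using (AbelianGroup)
open import Algebra.Morphism.Bundles using (GroupHomomorphism)
open import Data.Bool.Base using (true; false; if_then_else_)
open import Data.Fin.Base using (Fin; zero; suc; toℕ; _↑ˡ_; _↑ʳ_)
open import Data.List.Base using (List; []; _∷_; [_]; _++_; filter; map; length; lookup; removeAt)
open import Data.List.Membership.Propositional using (_∈_; _∉_)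
open import Data.List.Membership.Propositional.Properties
  using (∈-filter⁺; ∈-filter⁻; ∈-∃++; ∈-lookup; ∈-map⁺; ∈-map⁻; ∈-++⁺ˡ; ∈-++⁺ʳ; ∈-++⁻)
open import Data.List.Properties
  using (≡-dec; length-++; filter-++; filter-all; filter-reject; length-filter; map-++; ∷-injectiveʳ)
open import Data.List.Relation.Binary.Permutation.Propositional as ↭
  using (_↭_; ↭-refl; ↭-sym; ↭-trans; ↭-reflexive; ↭⇒↭ₛ)
open import Data.List.Relation.Binary.Permutation.Propositional.Properties
  using (shift; All-resp-↭; ↭-length; ∈-resp-↭; drop-∷; filter-↭; map⁺)
open import Data.List.Relation.Binary.Permutation.Setoid.Properties using (Unique-resp-↭)
open import Data.List.Relation.Binary.Sublist.Propositional
  using (_⊆_; []; _∷_; _∷ʳ_; ⊆-refl; ⊆-trans; minimum) renaming (lookup to ⊆⇒∈)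
open import Data.List.Relation.Binary.Sublist.Propositional.Properties using (filter-⊆)
open import Data.List.Relation.Unary.All as All using (All; []; _∷_)
open import Data.List.Relation.Unary.All.Properties using (all-filter)
open import Data.List.Relation.Unary.AllPairs using (AllPairs; []; _∷_; allPairs?)
open import Data.List.Relation.Unary.AllPairs.Properties as AllPairs using ()
open import Data.List.Relation.Unary.Any using (here; there; index)
open import Data.List.Relation.Unary.Any.Properties using (lookup-index)
open import Data.List.Relation.Unary.Linked as Linked using (Linked; []; [-]; _∷_)
open import Data.List.Relation.Unary.Linked.Properties using (Linked⇒AllPairs)
open import Data.List.Relation.Unary.Unique.Propositional using (Unique)
open import Data.List.Relation.Unary.Unique.Propositional.Properties as Unique using ()
open import Data.List.Sort using (sort; sort-↭; sort-↗)
open import Data.Nat.Base as ℕ using (ℕ; zero; suc; s≤s)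
open import Data.Nat.Properties as ℕ using ()
open import Data.Product.Base using (Σ-syntax; ∃-syntax; _×_; _,_; -,_; proj₁; proj₂)
open import Data.Sum.Base using (_⊎_; inj₁; inj₂)
open import Data.Unit.Base using (⊤; tt)
open import Data.Vec.Base as Vec using (Vec; _∷_; toList; fromList; updateAt)
open import Data.Vec.Functional as Vector using ()
open import Data.Vec.Functional.Properties using (lookup-++ˡ; lookup-++ʳ)
open import Data.Vec.Properties using (lookup∘updateAt′; toList∘fromList)
open import Function.Base using (_∘_; id)
open import Relation.Binary.Construct.Flip.EqAndOrd using () renaming (decTotalOrder to converse)
open import Relation.Binary.Construct.On using () renaming (decTotalOrder to on)
open import Relation.Binary.PropositionalEquality
  using (_≡_; _≢_; _≗_; refl; sym; trans; cong; cong₂; subst; subst₂; setoid; module ≡-Reasoning)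
open import Relation.Nullary.Decidable using (Dec; yes; no; does; _×-dec_)
open import Relation.Nullary.Negation using (¬_; contradiction)
open import Relation.Unary using (Decidable)

-- Nonemptiness of the links is the crux. The empty complex has a reduced class in degree -1, so an
-- empty link of a partition, or of a shift inside a link, would create a class in degree 0, which
-- is too low. A partition other than the one-row one has a heavier neighbour: move a cell from the
-- second row to the first. For a shift (p , q) and a different one (p′ , q′) at least as heavy, p′
-- < p or q < q′, and then (p′ , q) or (p , q′) is a strictly heavier shift, because the row that
-- loses a cell and the row that gains it can be chosen from different shifts. One level further in,
-- empty links are harmless: they open a second component, which is a class in degree 0.
--
-- Degrees are counted by the number of vertices of a face, so 2, 1, 0 and -1 appear as 3, 2, 1 and
-- 0. Freeness is carried by explicit bases: each basis class of a link is lifted to an actual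
-- cycle, so no extension problem arises. The order by weight differs from the order that orients
-- the faces; alternating functions make this immaterial.

-- Repetition-free lists, sublists and combinations.

sameElements⇒↭ : ∀ {A : Set} {xs ys : List A} → Unique xs → Unique ys →
                 (∀ {z} → z ∈ xs → z ∈ ys) → (∀ {z} → z ∈ ys → z ∈ xs) → xs ↭ ys
sameElements⇒↭ {xs = []} {[]}     _ _ _ _ = ↭-refl
sameElements⇒↭ {xs = []} {y ∷ ys} _ _ _ ys⊆ = contradiction (ys⊆ (here refl)) λ ()
sameElements⇒↭ {A} {x ∷ xs} {ys} (x∉xs ∷ u) v xs⊆ ys⊆
  with α , β , refl ← ∈-∃++ (xs⊆ (here refl))
  with x∉αβ ∷ v′ ← Unique-resp-↭ (setoid A) (↭⇒↭ₛ (shift x α β)) v =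
  ↭-trans (↭.prep x (sameElements⇒↭ u v′
    (λ z∈ → tail (All.lookup x∉xs z∈) (∈-resp-↭ (shift x α β) (xs⊆ (there z∈))))
    (λ z∈ → tail (All.lookup x∉αβ z∈) (ys⊆ (∈-resp-↭ (↭-sym (shift x α β)) (there z∈))))))
    (↭-sym (shift x α β))
  where
  tail : ∀ {y z} {zs : List A} → y ≢ z → z ∈ y ∷ zs → z ∈ zs
  tail y≢z (here refl) = contradiction refl y≢z
  tail y≢z (there z∈)  = z∈

Unique-⊆ : ∀ {A : Set} {xs ys : List A} → xs ⊆ ys → Unique ys → Unique xs
Unique-⊆ []         []       = []
Unique-⊆ (_ ∷ʳ p)   (_ ∷ u)  = Unique-⊆ p u
Unique-⊆ (refl ∷ p) (x∉ ∷ u) = All.tabulate (λ z∈ → All.lookup x∉ (⊆⇒∈ p z∈)) ∷ Unique-⊆ p u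

-- Sublists inherit the order of `xs`, so a set of vertices has only one representative among them.
-- This is what makes every face occur once in the list of faces.
↭⇒≡ : ∀ {A : Set} {xs σ τ : List A} → Unique xs → σ ⊆ xs → τ ⊆ xs → σ ↭ τ → σ ≡ τ
↭⇒≡ _        []         []         _   = refl
↭⇒≡ (_ ∷ u)  (_ ∷ʳ p)   (_ ∷ʳ q)   σ↭τ = ↭⇒≡ u p q σ↭τ
↭⇒≡ (_ ∷ u)  (refl ∷ p) (refl ∷ q) σ↭τ = cong (_ ∷_) (↭⇒≡ u p q (drop-∷ σ↭τ))
↭⇒≡ (x∉ ∷ _) (_ ∷ʳ p)   (refl ∷ q) σ↭τ =
  contradiction refl (All.lookup x∉ (⊆⇒∈ p (∈-resp-↭ (↭-sym σ↭τ) (here refl))))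
↭⇒≡ (x∉ ∷ _) (refl ∷ p) (_ ∷ʳ q)   σ↭τ =
  contradiction refl (All.lookup x∉ (⊆⇒∈ q (∈-resp-↭ σ↭τ (here refl))))

removeAt-⊆ : ∀ {A : Set} (xs : List A) i → removeAt xs i ⊆ xs
removeAt-⊆ (x ∷ xs) zero    = x ∷ʳ ⊆-refl
removeAt-⊆ (x ∷ xs) (suc i) = refl ∷ removeAt-⊆ xs i

module _ {A : Set} where

  ∈-combinations⁺ : ∀ {xs σ : List A} → σ ⊆ xs → σ ∈ combinations (length σ) xs
  ∈-combinations⁺ []                           = here refl
  ∈-combinations⁺ {σ = []}     (_ ∷ʳ _)        = here refl
  ∈-combinations⁺ {σ = s ∷ σ}  (x ∷ʳ p)        = ∈-++⁺ʳ (map (x ∷_) (combinations (length σ) _)) (∈-combinations⁺ p)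
  ∈-combinations⁺              (refl ∷ p)      = ∈-++⁺ˡ (∈-map⁺ (_ ∷_) (∈-combinations⁺ p))

  ∈-combinations⁻ : ∀ k (xs : List A) {σ} → σ ∈ combinations k xs → σ ⊆ xs × length σ ≡ k
  ∈-combinations⁻ zero    xs       (here refl) = minimum xs , refl
  ∈-combinations⁻ (suc k) (x ∷ xs) σ∈ with ∈-++⁻ (map (x ∷_) (combinations k xs)) σ∈
  ... | inj₁ σ∈ˡ with τ , τ∈ , refl ← ∈-map⁻ (x ∷_) σ∈ˡ with p , s ← ∈-combinations⁻ k xs τ∈ = refl ∷ p , cong suc s
  ... | inj₂ σ∈ʳ with p , s ← ∈-combinations⁻ (suc k) xs σ∈ʳ = x ∷ʳ p , s

  combinations-unique : ∀ k {xs : List A} → Unique xs → Unique (combinations k xs)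
  combinations-unique zero    _        = [] ∷ []
  combinations-unique (suc k) []       = []
  combinations-unique (suc k) {x ∷ xs} (x∉xs ∷ u) = Unique.++⁺
    (Unique.map⁺ ∷-injectiveʳ (combinations-unique k u)) (combinations-unique (suc k) u) λ (σ∈ˡ , σ∈ʳ) →
      ∷∉combinations (∈-map⁻ (x ∷_) σ∈ˡ) σ∈ʳ
    where
    ∷∉combinations : ∀ {σ} → ∃[ τ ] τ ∈ combinations k xs × σ ≡ x ∷ τ → ¬ σ ∈ combinations (suc k) xs
    ∷∉combinations (τ , _ , refl) σ∈ = All.lookup x∉xs (⊆⇒∈ (proj₁ (∈-combinations⁻ (suc k) xs σ∈)) (here refl)) refl

  module _ {P : A → Set} (P? : Decidable P) where

    filter-map-∷ : ∀ {x} → P x → ∀ σs → filter (All.all? P?) (map (x ∷_) σs) ≡ map (x ∷_) (filter (All.all? P?) σs)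
    filter-map-∷ {x} px []       = refl
    filter-map-∷ {x} px (σ ∷ σs) with P? x | All.all? P? σ
    ... | no ¬px | _     = contradiction px ¬px
    ... | yes _  | yes _ = cong (_ ∷_) (filter-map-∷ px σs)
    ... | yes _  | no _  = filter-map-∷ px σs

    filter-map-∷-reject : ∀ {x} → ¬ P x → ∀ σs → filter (All.all? P?) (map (x ∷_) σs) ≡ []
    filter-map-∷-reject ¬px []       = refl
    filter-map-∷-reject {x} ¬px (σ ∷ σs) = trans (filter-reject (All.all? P?) {x ∷ σ} {map (x ∷_) σs} λ { (px ∷ _) → ¬px px })
      (filter-map-∷-reject ¬px σs)

    -- With `P` adjacency to a vertex, this identifies the combinations to which that vertex can be
    -- prepended as those of its link.
    filter-combinations : ∀ k xs → filter (All.all? P?) (combinations k xs) ≡ combinations k (filter P? xs)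
    filter-combinations zero    xs       = refl
    filter-combinations (suc k) []       = refl
    filter-combinations (suc k) (x ∷ xs) = trans
      (filter-++ (All.all? P?) (map (x ∷_) (combinations k xs)) (combinations (suc k) xs)) rest
      where
      rest : filter (All.all? P?) (map (x ∷_) (combinations k xs)) ++ filter (All.all? P?) (combinations (suc k) xs)
             ≡ combinations (suc k) (filter P? (x ∷ xs))
      rest with P? x
      ... | yes px = cong₂ _++_ (trans (filter-map-∷ px (combinations k xs)) (cong (map (x ∷_)) (filter-combinations k xs)))
                                (filter-combinations (suc k) xs)
      ... | no ¬px = cong₂ _++_ (filter-map-∷-reject ¬px (combinations k xs)) (filter-combinations (suc k) xs)

lookup-injective : ∀ {A : Set} {xs : List A} → Unique xs → ∀ i j →
                   lookup xs i ≡ lookup xs j → i ≡ j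
lookup-injective (_ ∷ _)  zero    zero    _  = refl
lookup-injective (px ∷ _) zero    (suc j) eq = contradiction eq (All.lookup px (∈-lookup j))
lookup-injective (px ∷ _) (suc i) zero    eq = contradiction (sym eq) (All.lookup px (∈-lookup i))
lookup-injective (_ ∷ u)  (suc i) (suc j) eq = cong suc (lookup-injective u i j eq)

-- Finite sums of integers.

module IntegerSums where

  open import Data.Integer.Base using (ℤ; 0ℤ; _+_; _-_; _*_; -_)
  open import Data.Integer.Properties using (+-identityˡ; +-identityʳ; +-assoc; +-*-semiring)
  open import Data.Integer.Tactic.RingSolver using (solve-∀)
  open import Algebra.Properties.Semiring.Sum +-*-semiring
    using (sum; sum-syntax; sum-cong-≗; sum-replicate-zero; ∑-distrib-+)
  open ≡-Reasoning

  -- A nonzero integer and its negative have different constructors, so zero is the only case. It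
  -- turns the antisymmetry of a double sum into its vanishing.
  x≡-x⇒x≡0 : ∀ {x} → x ≡ - x → x ≡ 0ℤ
  x≡-x⇒x≡0 {ℤ.pos zero} _ = refl

  ∑-zero : ∀ {n} (f : Fin n → ℤ) → (∀ i → f i ≡ 0ℤ) → sum f ≡ 0ℤ
  ∑-zero {n} f f≗0 = trans (sum-cong-≗ f≗0) (sum-replicate-zero n)

  ∑-neg : ∀ {n} (f : Fin n → ℤ) → ∑[ i < n ] (- f i) ≡ - sum f
  ∑-neg {zero}  f = refl
  ∑-neg {suc n} f = trans (cong (λ □ → - f zero + □) (∑-neg (f ∘ suc))) (lemma (f zero) (sum (f ∘ suc)))
    where
    lemma : ∀ a b → - a + - b ≡ - (a + b)
    lemma = solve-∀

  ∑-distrib-- : ∀ {n} (f g : Fin n → ℤ) → ∑[ i < n ] (f i - g i) ≡ sum f - sum g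
  ∑-distrib-- f g = trans (∑-distrib-+ f (-_ ∘ g)) (cong (λ □ → sum f + □) (∑-neg g))

  ∑-single : ∀ {n} (f : Fin n → ℤ) i → (∀ j → j ≢ i → f j ≡ 0ℤ) → sum f ≡ f i
  ∑-single f zero f≗0 =
    trans (cong (λ □ → f zero + □) (∑-zero (f ∘ suc) λ j → f≗0 (suc j) λ ())) (+-identityʳ _)
  ∑-single f (suc i) f≗0 = trans
    (cong₂ _+_ (f≗0 zero λ ()) (∑-single (f ∘ suc) i λ j j≢i → f≗0 (suc j) λ { refl → j≢i refl }))
    (+-identityˡ _)

  ∑-↑ : ∀ m {n} (f : Fin (m ℕ.+ n) → ℤ) →
        sum f ≡ ∑[ i < m ] f (i ↑ˡ n) + ∑[ j < n ] f (m ↑ʳ j)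
  ∑-↑ zero    f = sym (+-identityˡ _)
  ∑-↑ (suc m) f = trans (cong (λ □ → f zero + □) (∑-↑ m (f ∘ suc))) (sym (+-assoc (f zero) _ _))

  ↑-elim : ∀ m {n} (P : Fin (m ℕ.+ n) → Set) → (∀ i → P (i ↑ˡ n)) → (∀ j → P (m ↑ʳ j)) → ∀ i → P i
  ↑-elim zero    P l r i       = r i
  ↑-elim (suc m) P l r zero    = l zero
  ↑-elim (suc m) P l r (suc i) = ↑-elim m (P ∘ suc) (l ∘ suc) r i

  lincomb : {X : Set} {r : ℕ} → (Fin r → ℤ) → (Fin r → X → ℤ) → X → ℤ
  lincomb {r = r} a g τ = ∑[ i < r ] (a i * g i τ)

  lincomb-++ : ∀ {X : Set} {m n} (a : Fin (m ℕ.+ n) → ℤ) (g : Fin m → X → ℤ) (h : Fin n → X → ℤ) τ →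
               lincomb a (g Vector.++ h) τ ≡ lincomb (a ∘ (_↑ˡ n)) g τ + lincomb (a ∘ (m ↑ʳ_)) h τ
  lincomb-++ {m = m} a g h τ = trans (∑-↑ m _) (cong₂ _+_
    (sum-cong-≗ λ i → cong (λ k → a (i ↑ˡ _) * k τ) (lookup-++ˡ g h i))
    (sum-cong-≗ λ j → cong (λ k → a (m ↑ʳ j) * k τ) (lookup-++ʳ g h j)))

open IntegerSums

-- Homology of clique complexes

module CliqueHomology (G : FiniteGraph) where

  open import Data.Integer.Base using (ℤ; 0ℤ; 1ℤ; _+_; _-_; _*_; -_)
  open import Data.Integer.Properties using (+-identityˡ; +-identityʳ; *-identityˡ; *-zeroˡ; *-zeroʳ; +-inverseʳ; +-*-semiring)
  open import Data.Integer.Tactic.RingSolver using (solve-∀)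
  open import Algebra.Properties.Semiring.Sum +-*-semiring
    using (sum-syntax; sum-cong-≗; sum-replicate-zero; ∑-distrib-+; ∑-comm; *-distribˡ-sum)
  open ≡-Reasoning

  open FiniteGraph G
  open FiniteSimplicialComplex (Cl G) using (face-↭)

  -- A list of vertices stands for the full subcomplex on it; `lk x xs` is the part of the complex
  -- on `xs` along which a new vertex `x` is attached.
  lk : Vertex → List Vertex → List Vertex
  lk x xs = filter (x ~?_) xs

  -- Oriented chains are encoded as alternating functions of vertex sequences supported on
  -- the faces: the boundary is then a sum without signs, and no order of the vertices matters.

  Function : Set
  Function = List Vertex → ℤ

  infixl 7 _⌟_
  _⌟_ : Function → Vertex → Function
  (c ⌟ x) τ = c (x ∷ τ)

  unit : Function
  unit []      = 1ℤ
  unit (_ ∷ _) = 0ℤ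

  δ : Vertex → Vertex → ℤ
  δ x y = if does (x ≟ y) then 1ℤ else 0ℤ

  δ-refl : ∀ x → δ x x ≡ 1ℤ
  δ-refl x with x ≟ x
  ... | yes _  = refl
  ... | no x≢x = contradiction refl x≢x

  δ-≢ : ∀ {x y} → x ≢ y → δ x y ≡ 0ℤ
  δ-≢ {x} {y} x≢y with x ≟ y
  ... | yes x≡y = contradiction x≡y x≢y
  ... | no _    = refl

  -- Exterior multiplication by `x`, that is, the cone with apex `x`. Unfolded, it deletes each
  -- occurrence of `x` from the argument in turn, with a sign alternating with the position.
  wedge : Vertex → Function → Function
  wedge x b []      = 0ℤ
  wedge x b (t ∷ τ) = δ x t * b τ - wedge x (b ⌟ t) τ

  v : Fin (length vertices) → Vertex
  v = lookup vertices

  -- The coefficient of `τ` in a boundary collects the values at `v ∷ τ`. Chains vanish off their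
  -- faces, so one formula serves all subcomplexes and all degrees.
  d : Function → Function
  d c τ = ∑[ i < length vertices ] c (v i ∷ τ)

  wedge-cong : ∀ x {b b′} → b ≗ b′ → wedge x b ≗ wedge x b′
  wedge-cong x b≗b′ []      = refl
  wedge-cong x b≗b′ (t ∷ τ) = cong₂ (λ u v → δ x t * u - v) (b≗b′ τ) (wedge-cong x (b≗b′ ∘ (t ∷_)) τ)

  wedge-∑ : ∀ x {n} (b : Fin n → Function) τ →
            wedge x (λ ρ → ∑[ i < n ] b i ρ) τ ≡ ∑[ i < n ] wedge x (b i) τ
  wedge-∑ x {n} b []      = sym (sum-replicate-zero n)
  wedge-∑ x {n} b (t ∷ τ) = trans
    (cong₂ _-_ (*-distribˡ-sum (δ x t) (λ i → b i τ)) (wedge-∑ x (λ i → b i ⌟ t) τ))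
    (sym (∑-distrib-- (λ i → δ x t * b i τ) (λ i → wedge x (b i ⌟ t) τ)))

  wedge-* : ∀ x a (b : Function) τ → wedge x (λ ρ → a * b ρ) τ ≡ a * wedge x b τ
  wedge-* x a b []      = sym (*-zeroʳ a)
  wedge-* x a b (t ∷ τ) = trans
    (cong (λ w → δ x t * (a * b τ) - w) (wedge-* x a (b ⌟ t) τ)) (lemma (δ x t) a (b τ) (wedge x (b ⌟ t) τ))
    where
    lemma : ∀ p a q r → p * (a * q) - a * r ≡ a * (p * q - r)
    lemma = solve-∀

  wedge-zero : ∀ x (b : Function) → (∀ τ → b τ ≡ 0ℤ) → ∀ τ → wedge x b τ ≡ 0ℤ
  wedge-zero x b b≗0 τ = trans (wedge-cong x b≗0 τ)
    (trans (wedge-* x 0ℤ b τ) (*-zeroˡ (wedge x b τ)))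

  wedge-neg : ∀ x (b : Function) τ → wedge x (λ ρ → - b ρ) τ ≡ - wedge x b τ
  wedge-neg x b τ = trans (wedge-cong x (λ ρ → neg (b ρ)) τ)
    (trans (wedge-* x (- 1ℤ) b τ) (sym (neg (wedge x b τ))))
    where
    neg : ∀ a → - a ≡ - 1ℤ * a
    neg = solve-∀

  -- Every term with a nonzero `δ` evaluates `b` at `τ` with one occurrence of `x` deleted.
  wedge-vanish : ∀ x (b : Function) τ → (∀ ρ → τ ↭ x ∷ ρ → b ρ ≡ 0ℤ) → wedge x b τ ≡ 0ℤ
  wedge-vanish x b []      bρ≡0 = refl
  wedge-vanish x b (t ∷ τ) bρ≡0 = cong₂ _-_ head
    (wedge-vanish x (b ⌟ t) τ λ ρ τ↭xρ →
      bρ≡0 (t ∷ ρ) (↭-trans (↭.prep t τ↭xρ) (↭.swap t x ↭-refl)))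
    where
    head : δ x t * b τ ≡ 0ℤ
    head with x ≟ t
    ... | yes refl = trans (*-identityˡ (b τ)) (bρ≡0 τ ↭-refl)
    ... | no  _    = refl

  wedge-⌟ : ∀ x (b : Function) → (∀ τ → b (x ∷ τ) ≡ 0ℤ) → wedge x b ⌟ x ≗ b
  wedge-⌟ x b bx≡0 τ = begin
    δ x x * b τ - wedge x (b ⌟ x) τ  ≡⟨ cong₂ (λ p q → p * b τ - q) (δ-refl x) (wedge-zero x (b ⌟ x) bx≡0 τ) ⟩
    1ℤ * b τ - 0ℤ                    ≡⟨ lemma (b τ) ⟩
    b τ                              ∎
    where
    lemma : ∀ a → 1ℤ * a - 0ℤ ≡ a
    lemma = solve-∀

  d-cong : ∀ {c c′} → c ≗ c′ → d c ≗ d c′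
  d-cong c≗c′ τ = sum-cong-≗ λ i → c≗c′ (v i ∷ τ)

  d-+ : ∀ (c c′ : Function) τ → d (λ ρ → c ρ + c′ ρ) τ ≡ d c τ + d c′ τ
  d-+ c c′ τ = ∑-distrib-+ (λ i → c (v i ∷ τ)) (λ i → c′ (v i ∷ τ))

  d-unit : ∀ τ → d unit τ ≡ 0ℤ
  d-unit τ = ∑-zero (λ i → unit (v i ∷ τ)) λ _ → refl

  d-neg : ∀ (c : Function) τ → d (λ ρ → - c ρ) τ ≡ - d c τ
  d-neg c τ = ∑-neg (λ i → c (v i ∷ τ))

  d-- : ∀ (c c′ : Function) τ → d (λ ρ → c ρ - c′ ρ) τ ≡ d c τ - d c′ τ
  d-- c c′ τ = ∑-distrib-- (λ i → c (v i ∷ τ)) (λ i → c′ (v i ∷ τ))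

  d-zero : ∀ (c : Function) → (∀ τ → c τ ≡ 0ℤ) → ∀ τ → d c τ ≡ 0ℤ
  d-zero c c≗0 τ = ∑-zero _ λ i → c≗0 (v i ∷ τ)

  d-lincomb : ∀ {r} (a : Fin r → ℤ) g τ → d (lincomb a g) τ ≡ lincomb a (d ∘ g) τ
  d-lincomb {r} a g τ = trans (∑-comm (λ i j → a j * g j (v i ∷ τ)))
    (sum-cong-≗ λ j → sym (*-distribˡ-sum (a j) (λ i → g j (v i ∷ τ))))

  ∑-δ : ∀ x a → ∑[ i < length vertices ] (δ x (v i) * a) ≡ a
  ∑-δ x a = begin
    ∑[ i < length vertices ] (δ x (v i) * a)  ≡⟨ ∑-single _ i₀ (λ j j≢i₀ → cong (_* a) (δ-≢ λ x≡vj →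
                                                   j≢i₀ (lookup-injective vertices-unique j i₀ (trans (sym x≡vj) x≡vi₀)))) ⟩
    δ x (v i₀) * a                            ≡⟨ cong (λ y → δ x y * a) (sym x≡vi₀) ⟩
    δ x x * a                                 ≡⟨ cong (_* a) (δ-refl x) ⟩
    1ℤ * a                                    ≡⟨ *-identityˡ a ⟩
    a                                         ∎
    where
    i₀ = index (vertices-complete x)
    x≡vi₀ = lookup-index (vertices-complete x)

  -- The cone formula, from which the explicit fillings and lifts below are made. The term `b τ`
  -- comes from the single index at which `v i` is `x`.
  d-wedge : ∀ x b τ → d (wedge x b) τ ≡ b τ - wedge x (d b) τ
  d-wedge x b τ = begin
    ∑[ i < length vertices ] (δ x (v i) * b τ - wedge x (b ⌟ v i) τ)
      ≡⟨ ∑-distrib-- (λ i → δ x (v i) * b τ) (λ i → wedge x (b ⌟ v i) τ) ⟩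
    ∑[ i < length vertices ] (δ x (v i) * b τ) - ∑[ i < length vertices ] wedge x (b ⌟ v i) τ
      ≡⟨ cong₂ _-_ (∑-δ x (b τ)) (sym (wedge-∑ x (λ i → b ⌟ v i) τ)) ⟩
    b τ - wedge x (d b) τ
      ∎

  -- Alternating functions, faces and chains.

  record Alternating (c : Function) : Set where
    constructor alternates
    field
      flip : ∀ α x y β → c (α ++ x ∷ y ∷ β) ≡ - c (α ++ y ∷ x ∷ β)

  open Alternating

  alternating-⌟ : ∀ {c} x → Alternating c → Alternating (c ⌟ x)
  alternating-⌟ x alt = alternates λ α → flip alt (x ∷ α)

  alternating-unit : Alternating unit
  alternating-unit = alternates λ { [] _ _ _ → refl ; (_ ∷ _) _ _ _ → refl }

  alternating-wedge : ∀ z {b} → Alternating b → Alternating (wedge z b)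
  flip (alternating-wedge z {b} alt) [] x y β = trans
    (cong (λ w → δ z x * b (y ∷ β) - (δ z y * b (x ∷ β) - w))
      (trans (wedge-cong z (flip alt [] x y) β) (wedge-neg z (b ⌟ y ⌟ x) β)))
    (lemma (δ z x * b (y ∷ β)) (δ z y * b (x ∷ β)) (wedge z (b ⌟ y ⌟ x) β))
    where
    lemma : ∀ p q w → p - (q - (- w)) ≡ - (q - (p - w))
    lemma = solve-∀
  flip (alternating-wedge z {b} alt) (t ∷ α) x y β = trans
    (cong₂ (λ u v → δ z t * u - v) (flip alt α x y β) (flip (alternating-wedge z (alternating-⌟ t alt)) α x y β))
    (lemma (δ z t) (b (α ++ y ∷ x ∷ β)) (wedge z (b ⌟ t) (α ++ y ∷ x ∷ β)))
    where
    lemma : ∀ p q w → p * (- q) - (- w) ≡ - (p * q - w)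
    lemma = solve-∀

  -- Both functions change by the same sign along a permutation, so agreement is transported without
  -- that sign ever being computed.
  alternating-≡ : ∀ {c c′} → Alternating c → Alternating c′ → ∀ {σ τ} → σ ↭ τ → c σ ≡ c′ σ → c τ ≡ c′ τ
  alternating-≡ alt alt′ ↭.refl        eq = eq
  alternating-≡ alt alt′ (↭.prep x p)  eq = alternating-≡ (alternating-⌟ x alt) (alternating-⌟ x alt′) p eq
  alternating-≡ {c} {c′} alt alt′ (↭.swap {xs = σ} x y p) eq =
    alternating-≡ (alternating-⌟ x (alternating-⌟ y alt)) (alternating-⌟ x (alternating-⌟ y alt′)) p (begin
      c (y ∷ x ∷ σ)     ≡⟨ flip alt [] y x σ ⟩
      - c (x ∷ y ∷ σ)   ≡⟨ cong -_ eq ⟩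
      - c′ (x ∷ y ∷ σ)  ≡⟨ flip alt′ [] y x σ ⟨
      c′ (y ∷ x ∷ σ)    ∎)
  alternating-≡ alt alt′ (↭.trans p q) eq = alternating-≡ alt alt′ q (alternating-≡ alt alt′ p eq)

  d-⌟ : ∀ {c} → Alternating c → ∀ x τ → d (c ⌟ x) τ ≡ - d c (x ∷ τ)
  d-⌟ {c} alt x τ = trans (sum-cong-≗ λ i → flip alt [] x (v i) τ) (∑-neg (λ i → c (v i ∷ x ∷ τ)))

  -- Exchanging the two summations and flipping the two front vertices shows that the double sum is
  -- its own negative.
  d-d : ∀ {c} → Alternating c → ∀ τ → d (d c) τ ≡ 0ℤ
  d-d {c} alt τ = x≡-x⇒x≡0 (begin
    ∑[ i < m ] d c (v i ∷ τ)         ≡⟨ ∑-comm (λ i j → c (v j ∷ v i ∷ τ)) ⟩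
    ∑[ j < m ] d (c ⌟ v j) τ         ≡⟨ sum-cong-≗ (λ j → d-⌟ alt (v j) τ) ⟩
    ∑[ j < m ] (- d c (v j ∷ τ))     ≡⟨ ∑-neg (λ j → d c (v j ∷ τ)) ⟩
    - d (d c) τ                      ∎)
    where
    m = length vertices

  -- Only membership in `xs` matters, so chains are unaffected when the vertices are reordered by
  -- weight.
  record Face (k : ℕ) (xs σ : List Vertex) : Set where
    constructor face
    field
      size   : length σ ≡ k
      within : All (_∈ xs) σ
      clique : AllPairs _~_ σ

  Face-↭ : ∀ {k xs σ τ} → σ ↭ τ → Face k xs σ → Face k xs τ
  Face-↭ p (face s w c) = face (trans (↭-length (↭-sym p)) s) (All-resp-↭ p w) (face-↭ p c)

  Face-tail : ∀ {k xs x σ} → Face (suc k) xs (x ∷ σ) → Face k xs σ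
  Face-tail (face refl (_ ∷ w) (_ ∷ c)) = face refl w c

  Face-∷ : ∀ {k x xs σ} → Face k (lk x xs) σ → Face (suc k) (x ∷ xs) (x ∷ σ)
  Face-∷ {x = x} {xs} (face s w c) = face (cong suc s)
    (here refl ∷ All.map (there ∘ proj₁ ∘ ∈-filter⁻ (x ~?_)) w)
    (All.map (λ y∈ → proj₂ (∈-filter⁻ (x ~?_) {xs = xs} y∈)) w ∷ c)

  Face-lk : ∀ {k x xs σ} → Face (suc k) (x ∷ xs) (x ∷ σ) → Face k (lk x xs) σ
  Face-lk {x = x} {xs} (face refl (_ ∷ w) (a ∷ c)) = face refl (All.zipWith in-lk (w , a)) c
    where
    in-lk : ∀ {y} → y ∈ x ∷ xs × x ~ y → y ∈ lk x xs
    in-lk (here refl , x~x) = contradiction x~x (~-irrefl refl)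
    in-lk (there y∈xs , x~y) = ∈-filter⁺ (x ~?_) y∈xs x~y

  Face-⊆ : ∀ {k xs ys σ} → (∀ {y} → y ∈ xs → y ∈ ys) → Face k xs σ → Face k ys σ
  Face-⊆ xs⊆ys (face s w c) = face s (All.map xs⊆ys w) c

  record IsChain (k : ℕ) (xs : List Vertex) (c : Function) : Set where
    constructor chain
    field
      alternating : Alternating c
      support     : ∀ σ → ¬ Face k xs σ → c σ ≡ 0ℤ

  open IsChain

  module _ {k : ℕ} {xs : List Vertex} where

    zero-chain : IsChain k xs (λ _ → 0ℤ)
    zero-chain = chain (alternates λ _ _ _ _ → refl) (λ _ _ → refl)

    chain-+ : ∀ {c c′} → IsChain k xs c → IsChain k xs c′ → IsChain k xs (λ τ → c τ + c′ τ)
    chain-+ {c} {c′} C C′ = chain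
      (alternates λ α x y β → trans (cong₂ _+_ (flip (alternating C) α x y β) (flip (alternating C′) α x y β))
        (lemma (c (α ++ y ∷ x ∷ β)) (c′ (α ++ y ∷ x ∷ β))))
      (λ σ ¬f → cong₂ _+_ (support C σ ¬f) (support C′ σ ¬f))
      where
      lemma : ∀ a b → - a + - b ≡ - (a + b)
      lemma = solve-∀

    chain-* : ∀ a {c} → IsChain k xs c → IsChain k xs (λ τ → a * c τ)
    chain-* a {c} C = chain
      (alternates λ α x y β → trans (cong (a *_) (flip (alternating C) α x y β)) (lemma a (c (α ++ y ∷ x ∷ β))))
      (λ σ ¬f → trans (cong (a *_) (support C σ ¬f)) (*-zeroʳ a))
      where
      lemma : ∀ a b → a * - b ≡ - (a * b)
      lemma = solve-∀

    chain-neg : ∀ {c} → IsChain k xs c → IsChain k xs (λ τ → - c τ)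
    chain-neg C = chain
      (alternates λ α x y β → cong -_ (flip (alternating C) α x y β))
      (λ σ ¬f → cong -_ (support C σ ¬f))

    chain-- : ∀ {c c′} → IsChain k xs c → IsChain k xs c′ → IsChain k xs (λ τ → c τ - c′ τ)
    chain-- C C′ = chain-+ C (chain-neg C′)

    chain-∑ : ∀ {r} {g : Fin r → Function} → (∀ i → IsChain k xs (g i)) → IsChain k xs (λ τ → ∑[ i < r ] g i τ)
    chain-∑ {g = g} C = chain
      (alternates λ α x y β → trans (sum-cong-≗ λ i → flip (alternating (C i)) α x y β) (∑-neg (λ i → g i (α ++ y ∷ x ∷ β))))
      (λ σ ¬f → ∑-zero _ λ i → support (C i) σ ¬f)

    chain-lincomb : ∀ {r} (a : Fin r → ℤ) {g} → (∀ i → IsChain k xs (g i)) → IsChain k xs (lincomb a g)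
    chain-lincomb a C = chain-∑ λ i → chain-* (a i) (C i)

  chain-⊆ : ∀ {k xs ys c} → (∀ {y} → y ∈ xs → y ∈ ys) → IsChain k xs c → IsChain k ys c
  chain-⊆ xs⊆ys (chain alt supp) = chain alt λ σ ¬f → supp σ (¬f ∘ Face-⊆ xs⊆ys)

  lk⊆ : ∀ {x xs y} → y ∈ lk x xs → y ∈ xs
  lk⊆ {x} = proj₁ ∘ ∈-filter⁻ (x ~?_)

  chain-d : ∀ {k xs c} → IsChain (suc k) xs c → IsChain k xs (d c)
  chain-d {c = c} (chain alt supp) = chain
    (alternates λ α x y β → trans (sum-cong-≗ λ i → flip alt (v i ∷ α) x y β) (∑-neg (λ i → c (v i ∷ α ++ y ∷ x ∷ β))))
    (λ σ ¬f → ∑-zero _ λ i → supp (v i ∷ σ) (¬f ∘ Face-tail))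

  chain-wedge : ∀ {k x xs b} → IsChain k (lk x xs) b → IsChain (suc k) (x ∷ xs) (wedge x b)
  chain-wedge {x = x} {b = b} (chain alt supp) = chain (alternating-wedge x alt) λ σ ¬f →
    wedge-vanish x b σ λ ρ σ↭xρ → supp ρ λ f → ¬f (Face-↭ (↭-sym σ↭xρ) (Face-∷ f))

  chain-⌟ : ∀ {k x xs c} → IsChain (suc k) (x ∷ xs) c → IsChain k (lk x xs) (c ⌟ x)
  chain-⌟ {x = x} (chain alt supp) = chain (alternating-⌟ x alt) λ σ ¬f → supp (x ∷ σ) (¬f ∘ Face-lk)

  chain-∉ : ∀ {k x xs c} → x ∉ xs → IsChain k xs c → ∀ τ → c (x ∷ τ) ≡ 0ℤ
  chain-∉ x∉xs (chain _ supp) τ = supp (_ ∷ τ) (x∉xs ∘ All.head ∘ Face.within)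

  -- A sequence containing `x` is a permutation of one that begins with `x`, where `c` agrees with
  -- the zero chain; the agreement is carried back by alternation.
  chain-drop : ∀ {k x xs c} → IsChain k (x ∷ xs) c → (∀ τ → c (x ∷ τ) ≡ 0ℤ) → IsChain k xs c
  chain-drop {k} {x} {xs} {c} (chain alt supp) cx≡0 = chain alt supp′
    where
    open import Data.List.Membership.DecPropositional _≟_ using (_∈?_)
    supp′ : ∀ σ → ¬ Face k xs σ → c σ ≡ 0ℤ
    supp′ σ ¬f with x ∈? σ
    ... | yes x∈σ with α , β , refl ← ∈-∃++ x∈σ =
      alternating-≡ alt (alternating (zero-chain {k} {xs})) (↭-sym (shift x α β)) (cx≡0 (α ++ β))
    ... | no x∉σ = supp σ λ (face s w cl) → ¬f (face s (All.tabulate λ {y} y∈σ → drop y∈σ (All.lookup w y∈σ)) cl)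
      where
      drop : ∀ {y} → y ∈ σ → y ∈ x ∷ xs → y ∈ xs
      drop y∈σ (here refl)  = contradiction y∈σ x∉σ
      drop y∈σ (there y∈xs) = y∈xs

  chain-0-⊆ : ∀ {xs ys c} → IsChain 0 xs c → IsChain 0 ys c
  chain-0-⊆ (chain alt supp) = chain alt λ
    { []      ¬f → contradiction (face refl [] []) ¬f
    ; (x ∷ σ) _  → supp (x ∷ σ) λ () }

  -- Cycles and explicit bases of homology.

  record IsCycle (k : ℕ) (xs : List Vertex) (c : Function) : Set where
    constructor cycle
    field
      isChain : IsChain k xs c
      closed  : ∀ τ → d c τ ≡ 0ℤ

  open IsCycle

  -- The coordinates of the class of c in terms of the classes of g.
  record Represents k xs {r} (g : Fin r → Function) (c : Function) (a : Fin r → ℤ) : Set where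
    constructor represents
    field
      filling       : Function
      filling-chain : IsChain (suc k) xs filling
      equation      : ∀ τ → c τ ≡ lincomb a g τ + d filling τ

  open Represents

  Spans : ∀ k xs {r} → (Fin r → Function) → Set
  Spans k xs g = ∀ c → IsCycle k xs c → ∃[ a ] Represents k xs g c a

  Independent : ∀ k xs {r} → (Fin r → Function) → Set
  Independent k xs g = ∀ a e → IsChain (suc k) xs e → (∀ τ → lincomb a g τ + d e τ ≡ 0ℤ) → ∀ i → a i ≡ 0ℤ

  -- As `k` counts vertices, this is a basis of the reduced homology in degree `k - 1`.
  record Basis (k : ℕ) (xs : List Vertex) (r : ℕ) : Set where
    field
      generator   : Fin r → Function
      isCycle     : ∀ i → IsCycle k xs (generator i)
      spans       : Spans k xs generator
      independent : Independent k xs generator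

  none : Fin 0 → Function
  none ()

  -- Vanishing homology is expressed as being spanned by the empty family, so that `spans-∷` treats
  -- it together with spanning by a basis.
  Exact : ℕ → List Vertex → Set
  Exact k xs = Spans k xs none

  fill : ∀ {k xs} → Exact k xs → ∀ {c} → IsCycle k xs c → ∃[ e ] IsChain (suc k) xs e × c ≗ d e
  fill exact c-cycle with _ , represents e E c≗ ← exact _ c-cycle =
    e , E , λ τ → trans (c≗ τ) (+-identityˡ _)

  record Spherical (s : ℕ) (xs : List Vertex) (r : ℕ) : Set where
    field
      basis : Basis s xs r
      exact : ∀ k → k ≢ s → Exact k xs

  cycle-⌟ : ∀ {k x xs c} → IsCycle (suc k) (x ∷ xs) c → IsCycle k (lk x xs) (c ⌟ x)
  cycle-⌟ {x = x} (cycle C dc≡0) =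
    cycle (chain-⌟ C) λ τ → trans (d-⌟ (alternating C) x τ) (cong -_ (dc≡0 (x ∷ τ)))

  cycle-lincomb : ∀ {k xs r} (a : Fin r → ℤ) {g} → (∀ i → IsCycle k xs (g i)) → IsCycle k xs (lincomb a g)
  cycle-lincomb a {g} Z = cycle (chain-lincomb a (isChain ∘ Z)) λ τ → trans (d-lincomb a g τ)
    (∑-zero _ λ i → trans (cong (a i *_) (closed (Z i) τ)) (*-zeroʳ (a i)))

  x∉lk : ∀ {x} xs → x ∉ lk x xs
  x∉lk {x} xs x∈lk = ~-irrefl refl (proj₂ (∈-filter⁻ (x ~?_) {xs = xs} x∈lk))

  d-wedge-⌟ : ∀ {k x xs b} → IsChain (suc k) (lk x xs) b → ∀ τ → d (wedge x b) (x ∷ τ) ≡ - d b τ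
  d-wedge-⌟ {x = x} {xs} {b} B τ = begin
    d (wedge x b) (x ∷ τ)                ≡⟨ d-wedge x b (x ∷ τ) ⟩
    b (x ∷ τ) - wedge x (d b) (x ∷ τ)    ≡⟨ cong₂ _-_ (chain-∉ (x∉lk xs) B τ)
                                              (wedge-⌟ x (d b) (chain-∉ (x∉lk xs) (chain-d B)) τ) ⟩
    0ℤ - d b τ                           ≡⟨ +-identityˡ _ ⟩
    - d b τ                              ∎

  -- Attaching a vertex along its link.

  module _ {k x xs r₁ r₂} {ζ : Fin r₁ → Function} {z : Fin r₂ → Function}
           {lift : Fin r₁ → Function}
           (lift-cycle : ∀ i → IsCycle (suc k) (x ∷ xs) (lift i)) (lift-⌟ : ∀ i → lift i ⌟ x ≗ ζ i)
           where

    lincomb-lift-⌟ : ∀ a → lincomb a lift ⌟ x ≗ lincomb a ζ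
    lincomb-lift-⌟ a τ = sum-cong-≗ λ i → cong (a i *_) (lift-⌟ i τ)

    -- Subtracting the lifted link class of `c` and correcting by the boundary of a cone over `e`
    -- clears all coefficients at faces through `x`; a cycle on `xs` remains.
    module Reduce {c} (Z : IsCycle (suc k) (x ∷ xs) c) (a₁ : Fin r₁ → ℤ) {e}
                  (E : IsChain (suc k) (lk x xs) e) (cx≗ : ∀ τ → c (x ∷ τ) ≡ lincomb a₁ ζ τ + d e τ) where

      u f c′ : Function
      u = lincomb a₁ lift
      f = wedge x e
      -- The boundary `d f` is added because its contraction by `x` is `- d e`, which cancels the
      -- `d e` of `cx≗`.
      c′ τ = c τ - u τ + d f τ

      U : IsCycle (suc k) (x ∷ xs) u
      U = cycle-lincomb a₁ lift-cycle

      F : IsChain (suc (suc k)) (x ∷ xs) f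
      F = chain-wedge E

      c′-⌟ : ∀ τ → c′ (x ∷ τ) ≡ 0ℤ
      c′-⌟ τ = trans
        (cong₂ _+_ (cong₂ _-_ (cx≗ τ) (lincomb-lift-⌟ a₁ τ)) (d-wedge-⌟ {xs = xs} E τ))
        (lemma (lincomb a₁ ζ τ) (d e τ))
        where
        lemma : ∀ p q → p + q - p + - q ≡ 0ℤ
        lemma = solve-∀

      c′-cycle : IsCycle (suc k) xs c′
      c′-cycle = cycle
        (chain-drop (chain-+ (chain-- (isChain Z) (isChain U)) (chain-d F)) c′-⌟)
        λ τ → trans (d-+ (λ ρ → c ρ - u ρ) (d f) τ) (cong₂ _+_
          (trans (d-- c u τ) (cong₂ _-_ (closed Z τ) (closed U τ)))
          (d-d (alternating F) τ))

    -- This is exactness in the middle of H(`xs`) → H(`x ∷ xs`) → H(`lk x xs`), the second map being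
    -- contraction by `x`: the link class gives the coordinates on `lift`, the remainder those on
    -- `z`.
    spans-∷ : Spans k (lk x xs) ζ → Spans (suc k) xs z → Spans (suc k) (x ∷ xs) (lift Vector.++ z)
    spans-∷ spansζ spansz c Z = a , represents (λ τ → e′ τ - f τ) (chain-- (chain-⊆ there E′) F) c≗
      where
      c-⌟-spanned = spansζ (c ⌟ x) (cycle-⌟ Z)
      a₁ = proj₁ c-⌟-spanned
      open Reduce Z a₁ (filling-chain (proj₂ c-⌟-spanned)) (equation (proj₂ c-⌟-spanned))
      c′-spanned = spansz c′ c′-cycle
      a₂ = proj₁ c′-spanned
      e′ = filling (proj₂ c′-spanned)
      E′ = filling-chain (proj₂ c′-spanned)
      a = a₁ Vector.++ a₂
      c≗ : ∀ τ → c τ ≡ lincomb a (lift Vector.++ z) τ + d (λ ρ → e′ ρ - f ρ) τ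
      c≗ τ = begin
        c τ
          ≡⟨ lemma₁ (c τ) (u τ) (d f τ) ⟩
        c′ τ + (u τ - d f τ)
          ≡⟨ cong (_+ (u τ - d f τ)) (equation (proj₂ c′-spanned) τ) ⟩
        (lincomb a₂ z τ + d e′ τ) + (u τ - d f τ)
          ≡⟨ lemma₂ (lincomb a₂ z τ) (d e′ τ) (u τ) (d f τ) ⟩
        (u τ + lincomb a₂ z τ) + (d e′ τ - d f τ)
          ≡⟨ cong₂ _+_ split (d-- e′ f τ) ⟨
        lincomb a (lift Vector.++ z) τ + d (λ ρ → e′ ρ - f ρ) τ
          ∎
        where
        lemma₁ : ∀ p q r → p ≡ (p - q + r) + (q - r)
        lemma₁ = solve-∀
        lemma₂ : ∀ p q r s → (p + q) + (r - s) ≡ (r + p) + (q - s)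
        lemma₂ = solve-∀
        split : lincomb a (lift Vector.++ z) τ ≡ u τ + lincomb a₂ z τ
        split = trans (lincomb-++ a lift z τ) (cong₂ _+_
          (sum-cong-≗ λ i → cong (_* lift i τ) (lookup-++ˡ a₁ a₂ i))
          (sum-cong-≗ λ i → cong (_* z i τ) (lookup-++ʳ a₁ a₂ i)))

  -- The only face of the empty complex is the empty face, so its reduced homology is one copy of
  -- the integers in degree -1.
  spherical-[] : Spherical 0 [] 1
  spherical-[] = record
    { basis = record
      { generator   = λ _ → unit
      ; isCycle     = λ _ → cycle unit-chain d-unit
      ; spans       = λ c (cycle C _) → (λ _ → c []) , represents (λ _ → 0ℤ) zero-chain (unit-spans C)
      ; independent = λ { a e E eq zero → begin
          a zero                              ≡⟨ lemma (a zero) ⟩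
          a zero * 1ℤ + 0ℤ + 0ℤ               ≡⟨ cong (λ □ → a zero * 1ℤ + 0ℤ + □) (d-zero e (vanish (λ ()) E) []) ⟨
          a zero * 1ℤ + 0ℤ + d e []           ≡⟨ eq [] ⟩
          0ℤ                                  ∎ }
      }
    ; exact = λ k k≢0 c (cycle C _) → (λ ()) , represents (λ _ → 0ℤ) zero-chain
        λ τ → trans (vanish k≢0 C τ) (sym (trans (+-identityˡ _) (d-zero (λ _ → 0ℤ) (λ _ → refl) τ)))
    }
    where
    unit-chain : IsChain 0 [] unit
    unit-chain = chain alternating-unit
      λ { [] ¬f → contradiction (face refl [] []) ¬f ; (_ ∷ _) _ → refl }
    lemma : ∀ p → p ≡ p * 1ℤ + 0ℤ + 0ℤ
    lemma = solve-∀
    lemma₀ : ∀ p → p * 0ℤ + 0ℤ ≡ 0ℤ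
    lemma₀ = solve-∀
    vanish : ∀ {k c} → k ≢ 0 → IsChain k [] c → ∀ τ → c τ ≡ 0ℤ
    vanish k≢0 C τ = support C τ λ
      { (face refl [] _) → k≢0 refl
      ; (face _ (() ∷ _) _) }
    unit-spans : ∀ {c} → IsChain 0 [] c → ∀ τ → c τ ≡ (c [] * unit τ + 0ℤ) + d (λ _ → 0ℤ) τ
    unit-spans {c} C []      = trans (lemma (c [])) (cong (λ □ → c [] * 1ℤ + 0ℤ + □) (sym (d-zero (λ _ → 0ℤ) (λ _ → refl) [])))
    unit-spans {c} C (x ∷ τ) = trans (support C (x ∷ τ) λ { (face () _ _) })
      (sym (cong₂ _+_ (lemma₀ (c [])) (d-zero (λ _ → 0ℤ) (λ _ → refl) (x ∷ τ))))

  exact-∷ : ∀ {k x xs} → Exact k (lk x xs) → Exact (suc k) xs → Exact (suc k) (x ∷ xs)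
  exact-∷ {k} {x} {xs} exactlk exactxs c Z = (λ ()) , represents (filling R) (filling-chain R) (equation R)
    where
    spans : Spans (suc k) (x ∷ xs) (none Vector.++ none)
    spans = spans-∷ {ζ = none} {z = none} {lift = none} (λ ()) (λ ()) exactlk exactxs
    R = proj₂ (spans c Z)

  -- Split `c` into `wedge x (c ⌟ x)` and the part `b` on faces avoiding `x`. Since `x` is adjacent
  -- to everything, `b` lives on the link, and the cone over `b` has boundary `c`.
  exact-cone : ∀ {x xs} → All (x ~_) xs → x ∉ xs → ∀ k → Exact k (x ∷ xs)
  -- A chain on the empty face cannot be contracted, but it already lies in the link, so it is coned
  -- off directly.
  exact-cone {x} {xs} x~xs x∉xs zero c (cycle C dc≡0) =
    (λ ()) , represents (wedge x c) (chain-wedge (chain-0-⊆ C)) λ τ → sym (begin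
      0ℤ + d (wedge x c) τ           ≡⟨ cong (λ □ → 0ℤ + □) (d-wedge x c τ) ⟩
      0ℤ + (c τ - wedge x (d c) τ)   ≡⟨ cong (λ w → 0ℤ + (c τ - w)) (wedge-zero x (d c) dc≡0 τ) ⟩
      0ℤ + (c τ - 0ℤ)                ≡⟨ lemma (c τ) ⟩
      c τ                            ∎)
    where
    lemma : ∀ p → 0ℤ + (p - 0ℤ) ≡ p
    lemma = solve-∀
  exact-cone {x} {xs} x~xs x∉xs (suc k) c Z@(cycle C dc≡0) =
    (λ ()) , represents (wedge x b) (chain-wedge (chain-⊆ in-lk B)) λ τ → sym (begin
      0ℤ + d (wedge x b) τ                ≡⟨ cong (λ □ → 0ℤ + □) (d-wedge x b τ) ⟩
      0ℤ + (b τ - wedge x (d b) τ)        ≡⟨ cong (λ w → 0ℤ + (b τ - w)) (wedge-cong x db τ) ⟩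
      0ℤ + (b τ - wedge x (λ ρ → - (c ⌟ x) ρ) τ)
                                          ≡⟨ cong (λ w → 0ℤ + (b τ - w)) (wedge-neg x (c ⌟ x) τ) ⟩
      0ℤ + (b τ - - wedge x (c ⌟ x) τ)    ≡⟨ lemma (c τ) (wedge x (c ⌟ x) τ) ⟩
      c τ                                 ∎)
    where
    b : Function
    b τ = c τ - wedge x (c ⌟ x) τ
    in-lk : ∀ {y} → y ∈ xs → y ∈ lk x xs
    in-lk y∈xs = ∈-filter⁺ (x ~?_) y∈xs (All.lookup x~xs y∈xs)
    C⌟ : IsCycle k (lk x xs) (c ⌟ x)
    C⌟ = cycle-⌟ Z
    B : IsChain (suc k) xs b
    B = chain-drop (chain-- C (chain-wedge (isChain C⌟))) λ τ →
      trans (cong (λ w → c (x ∷ τ) - w) (wedge-⌟ x (c ⌟ x) (chain-∉ (x∉lk xs) (isChain C⌟)) τ)) (+-inverseʳ (c (x ∷ τ)))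
    db : ∀ τ → d b τ ≡ - c (x ∷ τ)
    db τ = begin
      d b τ                                     ≡⟨ d-- c (wedge x (c ⌟ x)) τ ⟩
      d c τ - d (wedge x (c ⌟ x)) τ             ≡⟨ cong₂ _-_ (dc≡0 τ) (d-wedge x (c ⌟ x) τ) ⟩
      0ℤ - (c (x ∷ τ) - wedge x (d (c ⌟ x)) τ)  ≡⟨ cong (λ w → 0ℤ - (c (x ∷ τ) - w)) (wedge-zero x (d (c ⌟ x)) (closed C⌟) τ) ⟩
      0ℤ - (c (x ∷ τ) - 0ℤ)                     ≡⟨ lemma₁ (c (x ∷ τ)) ⟩
      - c (x ∷ τ)                               ∎
      where
      lemma₁ : ∀ p → 0ℤ - (p - 0ℤ) ≡ - p
      lemma₁ = solve-∀
    lemma : ∀ p q → 0ℤ + ((p - q) - - q) ≡ p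
    lemma = solve-∀

  spherical-cone : ∀ {x xs} → All (x ~_) xs → x ∉ xs → ∀ s → Spherical s (x ∷ xs) 0
  spherical-cone x~xs x∉xs s = record
    { basis = record
      { generator   = none
      ; isCycle     = λ ()
      ; spans       = exact-cone x~xs x∉xs s
      ; independent = λ _ _ _ _ ()
      }
    ; exact = λ k _ → exact-cone x~xs x∉xs k
    }

  -- The long exact sequence reduces to 0 → H(`xs`) → H(`x ∷ xs`) → H(`lk x xs`) → 0. A link cycle
  -- `ζ i` bounds some `w i` on `xs`, which has no homology in that degree, and gluing the cone over
  -- `ζ i` to `w i` gives the lift that splits the sequence.
  spherical-∷ : ∀ {s x xs r₁ r₂} → x ∉ xs →
                Spherical s (lk x xs) r₁ → Spherical (suc s) xs r₂ → Spherical (suc s) (x ∷ xs) (r₁ ℕ.+ r₂)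
  spherical-∷ {s} {x} {xs} {r₁} {r₂} x∉xs Sₗ Sₓ = record
    { basis = record
      { generator   = lift Vector.++ z
      ; isCycle     = ↑-elim r₁ (λ i → IsCycle (suc s) (x ∷ xs) ((lift Vector.++ z) i))
          (λ i → subst (IsCycle (suc s) (x ∷ xs)) (sym (lookup-++ˡ lift z i)) (lift-cycle i))
          (λ j → subst (IsCycle (suc s) (x ∷ xs)) (sym (lookup-++ʳ lift z j))
            (cycle (chain-⊆ there (isChain (Bₓ.isCycle j))) (closed (Bₓ.isCycle j))))
      ; spans       = spans-∷ lift-cycle lift-⌟ Bₗ.spans Bₓ.spans
      ; independent = independent
      }
    ; exact = exact
    }
    where
    module Sₗ = Spherical Sₗ
    module Sₓ = Spherical Sₓ
    module Bₗ = Basis Sₗ.basis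
    module Bₓ = Basis Sₓ.basis
    ζ = Bₗ.generator
    z = Bₓ.generator
    ζ-filled : ∀ i → ∃[ w ] IsChain (suc s) xs w × ζ i ≗ d w
    ζ-filled i = fill (Sₓ.exact s (ℕ.1+n≢n ∘ sym))
      (cycle (chain-⊆ lk⊆ (isChain (Bₗ.isCycle i))) (closed (Bₗ.isCycle i)))
    w : Fin r₁ → Function
    w = proj₁ ∘ ζ-filled
    W : ∀ i → IsChain (suc s) xs (w i)
    W = proj₁ ∘ proj₂ ∘ ζ-filled
    ζ≗dw : ∀ i → ζ i ≗ d (w i)
    ζ≗dw = proj₂ ∘ proj₂ ∘ ζ-filled
    lift : Fin r₁ → Function
    lift i τ = wedge x (ζ i) τ - w i τ
    lift-cycle : ∀ i → IsCycle (suc s) (x ∷ xs) (lift i)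
    lift-cycle i = cycle (chain-- (chain-wedge (isChain (Bₗ.isCycle i))) (chain-⊆ there (W i))) λ τ → begin
      d (lift i) τ                                 ≡⟨ d-- (wedge x (ζ i)) (w i) τ ⟩
      d (wedge x (ζ i)) τ - d (w i) τ              ≡⟨ cong₂ _-_ (d-wedge x (ζ i) τ) (sym (ζ≗dw i τ)) ⟩
      (ζ i τ - wedge x (d (ζ i)) τ) - ζ i τ        ≡⟨ cong (λ u → (ζ i τ - u) - ζ i τ)
                                                        (wedge-zero x (d (ζ i)) (closed (Bₗ.isCycle i)) τ) ⟩
      (ζ i τ - 0ℤ) - ζ i τ                         ≡⟨ lemma (ζ i τ) ⟩
      0ℤ                                           ∎
      where
      lemma : ∀ p → (p - 0ℤ) - p ≡ 0ℤ
      lemma = solve-∀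
    lift-⌟ : ∀ i → lift i ⌟ x ≗ ζ i
    lift-⌟ i τ = trans
      (cong₂ _-_ (wedge-⌟ x (ζ i) (chain-∉ (x∉lk xs) (isChain (Bₗ.isCycle i))) τ) (chain-∉ x∉xs (W i) τ))
      (+-identityʳ (ζ i τ))
    exact : ∀ k → k ≢ suc s → Exact k (x ∷ xs)
    -- Chains of size zero live on the empty face alone, so the filling found on `xs` still serves.
    exact zero    _   c (cycle C dc≡0) with Sₓ.exact 0 (λ ()) c (cycle (chain-0-⊆ C) dc≡0)
    ... | a , represents e E c≗ = a , represents e (chain-⊆ there E) c≗
    exact (suc k) k≢s = exact-∷ (Sₗ.exact k (k≢s ∘ cong suc)) (Sₓ.exact (suc k) k≢s)
    independent : Independent (suc s) (x ∷ xs) (lift Vector.++ z)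
    independent a e E eq = ↑-elim r₁ (λ i → a i ≡ 0ℤ) a₁≡0 a₂≡0
      where
      a₁ = a ∘ (_↑ˡ r₂)
      a₂ = a ∘ (r₁ ↑ʳ_)
      eq′ : ∀ τ → (lincomb a₁ lift τ + lincomb a₂ z τ) + d e τ ≡ 0ℤ
      eq′ τ = trans (cong (_+ d e τ) (sym (lincomb-++ a lift z τ))) (eq τ)
      lincomb-a₂-⌟ : ∀ τ → lincomb a₂ z (x ∷ τ) ≡ 0ℤ
      lincomb-a₂-⌟ τ = ∑-zero _ λ j → trans
        (cong (a₂ j *_) (chain-∉ x∉xs (isChain (Bₓ.isCycle j)) τ)) (*-zeroʳ (a₂ j))
      -- Contracting the relation by `x` removes the generators from `xs` and leaves a relation
      -- among the link classes.
      a₁≡0 : ∀ i → a₁ i ≡ 0ℤ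
      a₁≡0 = Bₗ.independent a₁ (λ τ → - e (x ∷ τ)) (chain-neg (chain-⌟ E)) λ τ → begin
        lincomb a₁ ζ τ + d (λ ρ → - e (x ∷ ρ)) τ
          ≡⟨ cong₂ _+_ (sum-cong-≗ λ i → cong (a₁ i *_) (sym (lift-⌟ i τ))) (d-neg (e ⌟ x) τ) ⟩
        lincomb a₁ lift (x ∷ τ) - d (e ⌟ x) τ
          ≡⟨ cong (λ u → lincomb a₁ lift (x ∷ τ) - u) (d-⌟ (alternating E) x τ) ⟩
        lincomb a₁ lift (x ∷ τ) - - d e (x ∷ τ)
          ≡⟨ lemma (lincomb a₁ lift (x ∷ τ)) (d e (x ∷ τ)) ⟩
        (lincomb a₁ lift (x ∷ τ) + 0ℤ) + d e (x ∷ τ)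
          ≡⟨ cong (λ u → (lincomb a₁ lift (x ∷ τ) + u) + d e (x ∷ τ)) (lincomb-a₂-⌟ τ) ⟨
        (lincomb a₁ lift (x ∷ τ) + lincomb a₂ z (x ∷ τ)) + d e (x ∷ τ)
          ≡⟨ eq′ (x ∷ τ) ⟩
        0ℤ ∎
        where
        lemma : ∀ p q → p - - q ≡ (p + 0ℤ) + q
        lemma = solve-∀
      lincomb-a₁ : ∀ τ → lincomb a₁ lift τ ≡ 0ℤ
      lincomb-a₁ τ = ∑-zero _ λ i → cong (_* lift i τ) (a₁≡0 i)
      e⌟-closed : ∀ τ → d (e ⌟ x) τ ≡ 0ℤ
      e⌟-closed τ = trans (d-⌟ (alternating E) x τ) (cong -_ (begin
        d e (x ∷ τ)                ≡⟨ +-identityˡ _ ⟨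
        (0ℤ + 0ℤ) + d e (x ∷ τ)    ≡⟨ cong₂ (λ u v → (u + v) + d e (x ∷ τ)) (lincomb-a₁ (x ∷ τ)) (lincomb-a₂-⌟ τ) ⟨
        _                          ≡⟨ eq′ (x ∷ τ) ⟩
        0ℤ                         ∎))
      -- With the lifts gone, `e ⌟ x` is a link cycle one degree above the homology of the link, so
      -- it bounds some `f`. Adding `d (wedge x f)` to `e` then clears the faces through `x` without
      -- changing its boundary.
      e⌟-filled = fill (Sₗ.exact (suc s) ℕ.1+n≢n) (cycle (chain-⌟ E) e⌟-closed)
      f = proj₁ e⌟-filled
      F = proj₁ (proj₂ e⌟-filled)
      e′ : Function
      e′ τ = e τ + d (wedge x f) τ
      E′ : IsChain (suc (suc s)) xs e′
      E′ = chain-drop (chain-+ E (chain-d (chain-wedge F))) λ τ → trans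
        (cong₂ _+_ (proj₂ (proj₂ e⌟-filled) τ) (d-wedge-⌟ {xs = xs} F τ)) (+-inverseʳ (d f τ))
      a₂≡0 : ∀ j → a₂ j ≡ 0ℤ
      a₂≡0 = Bₓ.independent a₂ e′ E′ λ τ → begin
        lincomb a₂ z τ + d e′ τ
          ≡⟨ cong (λ □ → lincomb a₂ z τ + □) (d-+ e (d (wedge x f)) τ) ⟩
        lincomb a₂ z τ + (d e τ + d (d (wedge x f)) τ)
          ≡⟨ cong (λ u → lincomb a₂ z τ + (d e τ + u)) (d-d (alternating (chain-wedge {xs = xs} F)) τ) ⟩
        lincomb a₂ z τ + (d e τ + 0ℤ)
          ≡⟨ lemma (lincomb a₂ z τ) (d e τ) ⟩
        (0ℤ + lincomb a₂ z τ) + d e τ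
          ≡⟨ cong (λ u → (u + lincomb a₂ z τ) + d e τ) (lincomb-a₁ τ) ⟨
        (lincomb a₁ lift τ + lincomb a₂ z τ) + d e τ
          ≡⟨ eq′ τ ⟩
        0ℤ ∎
        where
        lemma : ∀ p q → p + (q + 0ℤ) ≡ (0ℤ + p) + q
        lemma = solve-∀

  spherical-⊆⊇ : ∀ {s xs ys r} → (∀ {y} → y ∈ xs → y ∈ ys) → (∀ {y} → y ∈ ys → y ∈ xs) →
                 Spherical s xs r → Spherical s ys r
  spherical-⊆⊇ {xs = xs} {ys} xs⊆ys ys⊆xs S = record
    { basis = record
      { generator   = B.generator
      ; isCycle     = λ i → cycle⊆ xs⊆ys (B.isCycle i)
      ; spans       = spans B.spans
      ; independent = λ a e E → B.independent a e (chain-⊆ ys⊆xs E)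
      }
    ; exact = λ k k≢s → spans (Spherical.exact S k k≢s)
    }
    where
    module B = Basis (Spherical.basis S)
    cycle⊆ : ∀ {k xs ys c} → (∀ {y} → y ∈ xs → y ∈ ys) → IsCycle k xs c → IsCycle k ys c
    cycle⊆ xs⊆ys (cycle C dc≡0) = cycle (chain-⊆ xs⊆ys C) dc≡0
    spans : ∀ {k r} {g : Fin r → Function} → Spans k xs g → Spans k ys g
    spans spansg c Z with a , represents e E eq ← spansg c (cycle⊆ ys⊆xs Z) = a , represents e (chain-⊆ xs⊆ys E) eq

-- Decompositions and the Euler characteristic.

module Counting (G : FiniteGraph) where

  open import Data.Integer.Base using (ℤ; +_; 0ℤ; 1ℤ; -1ℤ; _+_; _-_; _*_; -_; _^_)
  open import Data.Integer.Properties using (+-identityˡ; +-identityʳ; *-zeroʳ; +-assoc; +-inverseʳ; pos-+; +-*-semiring)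
  open import Data.Integer.Tactic.RingSolver using (solve-∀)
  open import Algebra.Properties.Semiring.Sum +-*-semiring
    using (sum-syntax; sum-cong-≗)
  open ≡-Reasoning

  open FiniteGraph G
  open CliqueHomology G

  -- A record of how each vertex is attached, from which both the homology basis and the Euler
  -- characteristic follow by recursion with the same `r`. A cone is acyclic, hence of rank 0 for
  -- every `s`.
  data Decomposable : ℕ → List Vertex → ℕ → Set where
    empty : Decomposable 0 [] 1
    cone  : ∀ {s x xs} → All (x ~_) xs → Decomposable s (x ∷ xs) 0
    add   : ∀ {s x xs r₁ r₂} → Decomposable s (lk x xs) r₁ → Decomposable (suc s) xs r₂ →
            Decomposable (suc s) (x ∷ xs) (r₁ ℕ.+ r₂)

  decomposable⇒spherical : ∀ {s xs r} → Unique xs → Decomposable s xs r → Spherical s xs r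
  decomposable⇒spherical _ empty = spherical-[]
  decomposable⇒spherical (x∉xs ∷ _) (cone x~xs) =
    spherical-cone x~xs (λ x∈xs → All.lookup x∉xs x∈xs refl) _
  decomposable⇒spherical (x∉xs ∷ u) (add D D′) = spherical-∷ (λ x∈xs → All.lookup x∉xs x∈xs refl)
    (decomposable⇒spherical (Unique.filter⁺ (_ ~?_) u) D) (decomposable⇒spherical u D′)

  -- The split by whether a clique contains the head is the same as in the constructor `add`.
  #cliques : ℕ → List Vertex → ℕ
  #cliques zero    _        = 1
  #cliques (suc k) []       = 0
  #cliques (suc k) (x ∷ xs) = #cliques k (lk x xs) ℕ.+ #cliques (suc k) xs

  #cliques≡#faces : ∀ k xs → #cliques k xs ≡ length (filter (allPairs? _~?_) (combinations k xs))
  #cliques≡#faces zero    _        = refl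
  #cliques≡#faces (suc k) []       = refl
  #cliques≡#faces (suc k) (x ∷ xs) = sym (begin
    length (filter (allPairs? _~?_) (map (x ∷_) (combinations k xs) ++ combinations (suc k) xs))
      ≡⟨ cong length (filter-++ (allPairs? _~?_) (map (x ∷_) (combinations k xs)) _) ⟩
    length (filter (allPairs? _~?_) (map (x ∷_) (combinations k xs)) ++ _)
      ≡⟨ length-++ (filter (allPairs? _~?_) (map (x ∷_) (combinations k xs))) ⟩
    length (filter (allPairs? _~?_) (map (x ∷_) (combinations k xs))) ℕ.+ _
      ≡⟨ cong₂ ℕ._+_ (trans (count (combinations k xs)) (cong (length ∘ filter (allPairs? _~?_))
           (filter-combinations (x ~?_) k xs))) (sym (#cliques≡#faces (suc k) xs)) ⟩
    length (filter (allPairs? _~?_) (combinations k (lk x xs))) ℕ.+ #cliques (suc k) xs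
      ≡⟨ cong (ℕ._+ #cliques (suc k) xs) (#cliques≡#faces k (lk x xs)) ⟨
    #cliques (suc k) (x ∷ xs)
      ∎)
    where
    count : ∀ σs → length (filter (allPairs? _~?_) (map (x ∷_) σs))
                   ≡ length (filter (allPairs? _~?_) (filter (All.all? (x ~?_)) σs))
    count []       = refl
    count (σ ∷ σs) with All.all? (x ~?_) σ
    ... | no _  = count σs
    ... | yes _ with allPairs? _~?_ σ
    ...   | yes _ = cong suc (count σs)
    ...   | no _  = count σs

  lk-comm : ∀ x y xs → lk x (lk y xs) ≡ lk y (lk x xs)
  lk-comm x y []       = refl
  lk-comm x y (z ∷ zs) with x ~? z in p | y ~? z in q
  ... | yes _ | yes _ rewrite p | q = cong (z ∷_) (lk-comm x y zs)
  ... | yes _ | no _  rewrite q     = lk-comm x y zs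
  ... | no _  | yes _ rewrite p     = lk-comm x y zs
  ... | no _  | no _                = lk-comm x y zs

  -- Connects the order by weight with the order in which faces are listed. The content is in the
  -- swap: cliques through both `x` and `y` are counted in the link of `y` within that of `x`, or
  -- the other way round.
  #cliques-↭ : ∀ k {xs ys} → xs ↭ ys → #cliques k xs ≡ #cliques k ys
  #cliques-↭ zero    _             = refl
  #cliques-↭ (suc k) ↭.refl        = refl
  #cliques-↭ (suc k) (↭.prep x p)  = cong₂ ℕ._+_ (#cliques-↭ k (filter-↭ (x ~?_) p)) (#cliques-↭ (suc k) p)
  #cliques-↭ (suc k) (↭.trans p q) = trans (#cliques-↭ (suc k) p) (#cliques-↭ (suc k) q)
  #cliques-↭ (suc k) (↭.swap {xs} {ys} x y p) = begin
    #cliques k (lk x (y ∷ xs)) ℕ.+ (#cliques k (lk y xs) ℕ.+ #cliques (suc k) xs)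
      ≡⟨ swapped k ⟩
    #cliques k (lk y (x ∷ xs)) ℕ.+ (#cliques k (lk x xs) ℕ.+ #cliques (suc k) xs)
      ≡⟨ cong₂ ℕ._+_ (#cliques-↭ k (filter-↭ (y ~?_) (↭.prep x p)))
           (cong₂ ℕ._+_ (#cliques-↭ k (filter-↭ (x ~?_) p)) (#cliques-↭ (suc k) p)) ⟩
    #cliques (suc k) (y ∷ x ∷ ys)
      ∎
    where
    swapped : ∀ k → #cliques k (lk x (y ∷ xs)) ℕ.+ (#cliques k (lk y xs) ℕ.+ #cliques (suc k) xs)
                  ≡ #cliques k (lk y (x ∷ xs)) ℕ.+ (#cliques k (lk x xs) ℕ.+ #cliques (suc k) xs)
    swapped zero    = refl
    swapped (suc k) with x ~? y | y ~? x
    ... | no _    | no _    = lemma (#cliques (suc k) (lk x xs)) (#cliques (suc k) (lk y xs)) (#cliques (suc (suc k)) xs)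
      where
      lemma : ∀ a b c → a ℕ.+ (b ℕ.+ c) ≡ b ℕ.+ (a ℕ.+ c)
      lemma a b c = trans (sym (ℕ.+-assoc a b c)) (trans (cong (ℕ._+ c) (ℕ.+-comm a b)) (ℕ.+-assoc b a c))
    ... | yes x~y | no y≁x  = contradiction (~-sym x~y) y≁x
    ... | no x≁y  | yes y~x = contradiction (~-sym y~x) x≁y
    ... | yes _   | yes _   = lemma (#cliques k (lk y (lk x xs))) (#cliques (suc k) (lk x xs)) (#cliques (suc k) (lk y xs)) (#cliques k (lk x (lk y xs)))
                                        (#cliques (suc (suc k)) xs) (cong (#cliques k) (lk-comm y x xs))
      where
      lemma : ∀ a b c d e → a ≡ d → (a ℕ.+ b) ℕ.+ (c ℕ.+ e) ≡ (d ℕ.+ c) ℕ.+ (b ℕ.+ e)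
      lemma a b c d e refl = begin
        (a ℕ.+ b) ℕ.+ (c ℕ.+ e)   ≡⟨ ℕ.+-assoc a b (c ℕ.+ e) ⟩
        a ℕ.+ (b ℕ.+ (c ℕ.+ e))   ≡⟨ cong (a ℕ.+_) (trans (sym (ℕ.+-assoc b c e))
                                       (trans (cong (ℕ._+ e) (ℕ.+-comm b c)) (ℕ.+-assoc c b e))) ⟩
        a ℕ.+ (c ℕ.+ (b ℕ.+ e))   ≡⟨ ℕ.+-assoc a c (b ℕ.+ e) ⟨
        (a ℕ.+ c) ℕ.+ (b ℕ.+ e)   ∎

  #cliques-vanish : ∀ k xs → length xs ℕ.< k → #cliques k xs ≡ 0
  #cliques-vanish (suc k) []       _ = refl
  #cliques-vanish (suc k) (x ∷ xs) (s≤s l<k) = cong₂ ℕ._+_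
    (#cliques-vanish k (lk x xs) (ℕ.≤-<-trans (length-filter (x ~?_) xs) l<k))
    (#cliques-vanish (suc k) xs (ℕ.m<n⇒m<1+n l<k))

  -- Cliques are signed by their number of vertices and the empty clique is included, so for `M`
  -- above the length of `xs` this is 1 minus the Euler characteristic.
  euler : ℕ → List Vertex → ℤ
  euler M xs = ∑[ i < M ] (-1ℤ ^ toℕ i * + #cliques (toℕ i) xs)

  -- Prepending `x` to a clique of the link raises its size by one, which flips the sign and lowers
  -- the cut-off for the link to `M`.
  euler-∷ : ∀ M x xs → euler (suc M) (x ∷ xs) ≡ euler (suc M) xs - euler M (lk x xs)
  euler-∷ M x xs = begin
    1ℤ + ∑[ i < M ] (-1ℤ * s i * + (#cliques (toℕ i) (lk x xs) ℕ.+ #cliques (suc (toℕ i)) xs))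
      ≡⟨ cong (λ u → 1ℤ + u) (sum-cong-≗ λ i → trans
           (cong (-1ℤ * s i *_) (pos-+ (#cliques (toℕ i) (lk x xs)) (#cliques (suc (toℕ i)) xs)))
           (lemma₁ (s i) (+ #cliques (toℕ i) (lk x xs)) (+ #cliques (suc (toℕ i)) xs))) ⟩
    1ℤ + ∑[ i < M ] (-1ℤ * s i * + #cliques (suc (toℕ i)) xs - s i * + #cliques (toℕ i) (lk x xs))
      ≡⟨ cong (λ u → 1ℤ + u) (∑-distrib-- {M} (λ i → -1ℤ * s i * + #cliques (suc (toℕ i)) xs)
           (λ i → s i * + #cliques (toℕ i) (lk x xs))) ⟩
    1ℤ + (∑[ i < M ] (-1ℤ * s i * + #cliques (suc (toℕ i)) xs) - euler M (lk x xs))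
      ≡⟨ +-assoc 1ℤ (∑[ i < M ] (-1ℤ * s i * + #cliques (suc (toℕ i)) xs)) (- euler M (lk x xs)) ⟨
    euler (suc M) xs - euler M (lk x xs)
      ∎
    where
    s : Fin M → ℤ
    s i = -1ℤ ^ toℕ i
    lemma₁ : ∀ p a b → -1ℤ * p * (a + b) ≡ -1ℤ * p * b - p * a
    lemma₁ = solve-∀

  euler-[] : ∀ M → euler (suc M) [] ≡ 1ℤ
  euler-[] M = cong (λ □ → 1ℤ + □) (∑-zero {M} (λ i → -1ℤ * (-1ℤ ^ toℕ i) * 0ℤ) λ i → *-zeroʳ (-1ℤ * (-1ℤ ^ toℕ i)))

  -- For a cone the link is all of `xs`, and the two terms of `euler-∷` differ only in their
  -- cut-offs; no clique is larger than the list.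
  euler-stable : ∀ M xs → length xs ℕ.< M → euler (suc M) xs ≡ euler M xs
  euler-stable M xs l<M = trans (last M (λ i → -1ℤ ^ i * + #cliques i xs)) (trans
    (cong (λ m → euler M xs + -1ℤ ^ M * + m) (#cliques-vanish M xs l<M))
    (trans (cong (λ u → euler M xs + u) (*-zeroʳ (-1ℤ ^ M))) (+-identityʳ _)))
    where
    last : ∀ M (f : ℕ → ℤ) → ∑[ i < suc M ] f (toℕ i) ≡ ∑[ i < M ] f (toℕ i) + f M
    last zero    f = trans (+-identityʳ (f 0)) (sym (+-identityˡ (f 0)))
    last (suc M) f = trans (cong (λ □ → f 0 + □) (last M (f ∘ suc))) (sym (+-assoc (f 0) (∑[ i < M ] f (suc (toℕ i))) (f (suc M))))

  decomposable⇒euler : ∀ {s xs r} → Decomposable s xs r → ∀ M → length xs ℕ.< M → euler M xs ≡ -1ℤ ^ s * + r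
  decomposable⇒euler empty (suc M) _ = euler-[] M
  decomposable⇒euler {s} (cone {x = x} {xs} x~xs) (suc M) (s≤s l<M) = begin
    euler (suc M) (x ∷ xs)                ≡⟨ euler-∷ M x xs ⟩
    euler (suc M) xs - euler M (lk x xs)  ≡⟨ cong₂ _-_ (euler-stable M xs l<M)
                                              (cong (euler M) (filter-all (x ~?_) x~xs)) ⟩
    euler M xs - euler M xs               ≡⟨ +-inverseʳ (euler M xs) ⟩
    0ℤ                                    ≡⟨ *-zeroʳ (-1ℤ ^ s) ⟨
    -1ℤ ^ s * 0ℤ                          ∎
  decomposable⇒euler (add {s} {x} {xs} {r₁} {r₂} D D′) (suc M) (s≤s l<M) = begin
    euler (suc M) (x ∷ xs)                        ≡⟨ euler-∷ M x xs ⟩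
    euler (suc M) xs - euler M (lk x xs)          ≡⟨ cong₂ _-_ (decomposable⇒euler D′ (suc M) (ℕ.m<n⇒m<1+n l<M))
                                                      (decomposable⇒euler D M (ℕ.≤-<-trans (length-filter (x ~?_) xs) l<M)) ⟩
    -1ℤ * -1ℤ ^ s * + r₂ - -1ℤ ^ s * + r₁         ≡⟨ lemma (-1ℤ ^ s) (+ r₁) (+ r₂) ⟩
    -1ℤ * -1ℤ ^ s * (+ r₁ + + r₂)                 ≡⟨ cong (-1ℤ * -1ℤ ^ s *_) (pos-+ r₁ r₂) ⟨
    -1ℤ * -1ℤ ^ s * + (r₁ ℕ.+ r₂)                 ∎
    where
    lemma : ∀ p a b → -1ℤ * p * b - p * a ≡ -1ℤ * p * (a + b)
    lemma = solve-∀

-- Comparison with the oriented simplicial chain complex.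

module Comparison (G : FiniteGraph) where

  open import Data.Integer.Base using (ℤ; +_; -[1+_]; 0ℤ; 1ℤ; -1ℤ; _+_; _-_; _*_; -_; _^_)
  open import Data.Integer.Properties using (+-identityʳ; *-identityˡ; *-identityʳ; *-zeroʳ; +-inverseʳ; i-j≡0⇒i≡j; +-*-semiring)
  open import Data.Integer.Tactic.RingSolver using (solve-∀)
  open import Algebra.Properties.Semiring.Sum +-*-semiring
    using (sum-syntax; sum-cong-≗; ∑-distrib-+)
  open ≡-Reasoning

  open FiniteGraph G
  open FiniteSimplicialComplex (Cl G) using (face-↭; face-unique)
  open CliqueHomology G
  open Counting G

  private
    faceList : ℕ → List (List Vertex)
    faceList = faces (Cl G)

    faceAt : ∀ k → Fin (#faces (Cl G) k) → List Vertex
    faceAt k = lookup (faceList k)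

  -- For sequences of equal length this is the determinant of the values of `δ` on their entries,
  -- expanded along the first row: for a repetition-free `σ`, the sign of the permutation from `σ`
  -- to `τ`, or zero if there is none.
  simplex : List Vertex → Function
  simplex []      = unit
  simplex (s ∷ σ) = wedge s (simplex σ)

  simplex-alternating : ∀ σ → Alternating (simplex σ)
  simplex-alternating []      = alternating-unit
  simplex-alternating (s ∷ σ) = alternating-wedge s (simplex-alternating σ)

  simplex-vanish : ∀ σ τ → ¬ (σ ↭ τ) → simplex σ τ ≡ 0ℤ
  simplex-vanish []      []      ¬p = contradiction ↭-refl ¬p
  simplex-vanish []      (_ ∷ _) ¬p = refl
  simplex-vanish (s ∷ σ) τ       ¬p = wedge-vanish s (simplex σ) τ λ ρ τ↭sρ →
    simplex-vanish σ ρ λ σ↭ρ → ¬p (↭-trans (↭.prep s σ↭ρ) (↭-sym τ↭sρ))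

  simplex-self : ∀ {σ} → Unique σ → simplex σ σ ≡ 1ℤ
  simplex-self {[]}    _        = refl
  simplex-self {s ∷ σ} (s∉σ ∷ u) = begin
    δ s s * simplex σ σ - wedge s (simplex σ ⌟ s) σ
      ≡⟨ cong₂ _-_ (cong₂ _*_ (δ-refl s) (simplex-self u)) (wedge-vanish s (simplex σ ⌟ s) σ λ ρ σ↭sρ →
           contradiction refl (All.lookup s∉σ (∈-resp-↭ (↭-sym σ↭sρ) (here refl)))) ⟩
    1ℤ ∎

  simplex-⊆ : ∀ {σ τ} → σ ⊆ vertices → τ ⊆ vertices →
              simplex σ τ ≡ (if does (≡-dec _≟_ σ τ) then 1ℤ else 0ℤ)
  simplex-⊆ {σ} {τ} p q with ≡-dec _≟_ σ τ
  ... | yes refl = simplex-self (Unique-⊆ p vertices-unique)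
  ... | no σ≢τ   = simplex-vanish σ τ (σ≢τ ∘ ↭⇒≡ vertices-unique p q)

  -- The cone formula is applied once per vertex, and its minus sign advances the alternating signs
  -- by one position.
  d-simplex : ∀ σ τ → d (simplex σ) τ ≡ ∑[ i < length σ ] (-1ℤ ^ toℕ i * simplex (removeAt σ i) τ)
  d-simplex []      τ = d-unit τ
  d-simplex (s ∷ σ) τ = begin
    d (wedge s (simplex σ)) τ
      ≡⟨ d-wedge s (simplex σ) τ ⟩
    simplex σ τ - wedge s (d (simplex σ)) τ
      ≡⟨ cong (λ □ → simplex σ τ - □) (trans (wedge-cong s (d-simplex σ) τ)
           (trans (wedge-∑ s (λ i ρ → sign i * simplex (removeAt σ i) ρ) τ)
                  (sum-cong-≗ λ i → wedge-* s (sign i) (simplex (removeAt σ i)) τ))) ⟩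
    simplex σ τ - ∑[ i < length σ ] (sign i * simplex (s ∷ removeAt σ i) τ)
      ≡⟨ cong₂ _+_ (*-identityˡ (simplex σ τ)) (trans
           (sum-cong-≗ λ i → lemma (sign i) (simplex (s ∷ removeAt σ i) τ))
           (∑-neg (λ i → sign i * simplex (s ∷ removeAt σ i) τ))) ⟨
    1ℤ * simplex σ τ + ∑[ i < length σ ] (-1ℤ * sign i * simplex (s ∷ removeAt σ i) τ)
      ∎
    where
    sign : Fin (length σ) → ℤ
    sign i = -1ℤ ^ toℕ i
    lemma : ∀ p q → -1ℤ * p * q ≡ - (p * q)
    lemma = solve-∀

  incidence≡d : ∀ {σ τ} → σ ⊆ vertices → τ ⊆ vertices → incidence (Cl G) σ τ ≡ d (simplex σ) τ
  incidence≡d {σ} {τ} p q = trans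
    (sum-cong-≗ λ i → trans (scale (does (≡-dec _≟_ (removeAt σ i) τ)) (-1ℤ ^ toℕ i))
      (cong (-1ℤ ^ toℕ i *_) (sym (simplex-⊆ (⊆-trans (removeAt-⊆ σ i) p) q))))
    (sym (d-simplex σ τ))
    where
    scale : ∀ b a → (if b then a else 0ℤ) ≡ a * (if b then 1ℤ else 0ℤ)
    scale true  a = sym (*-identityʳ a)
    scale false a = sym (*-zeroʳ a)

  module _ (k : ℕ) where

    faces⁻ : ∀ {σ} → σ ∈ faceList k → σ ⊆ vertices × Face k vertices σ
    faces⁻ σ∈ with σ∈′ , cl ← ∈-filter⁻ (allPairs? _~?_) {xs = combinations k vertices} σ∈
      with p , s ← ∈-combinations⁻ k vertices σ∈′ = p , face s (All.tabulate (λ {y} _ → vertices-complete y)) cl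

    faceAt-⊆ : ∀ i → faceAt k i ⊆ vertices
    faceAt-⊆ i = proj₁ (faces⁻ (∈-lookup i))

    faceAt-face : ∀ i → Face k vertices (faceAt k i)
    faceAt-face i = proj₂ (faces⁻ (∈-lookup i))

    faces-unique : Unique (faceList k)
    faces-unique = Unique.filter⁺ (allPairs? _~?_) (combinations-unique k vertices-unique)

    faceAt-surjective : ∀ {τ} → Face k vertices τ → ∃[ i ] faceAt k i ↭ τ
    faceAt-surjective {τ} (face s w cl) =
      index σ∈ , ↭-trans (↭-reflexive (sym (lookup-index σ∈))) σ↭τ
      where
      open import Data.List.Membership.DecPropositional _≟_ using (_∈?_)
      -- The vertex set of `τ`, put in the order of `vertices`.
      σ = filter (_∈? τ) vertices
      σ↭τ : σ ↭ τ
      σ↭τ = sameElements⇒↭ (Unique.filter⁺ (_∈? τ) vertices-unique) (face-unique cl)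
        (λ z∈ → proj₂ (∈-filter⁻ (_∈? τ) {xs = vertices} z∈))
        (λ {z} z∈ → ∈-filter⁺ (_∈? τ) (vertices-complete z) z∈)
      σ∈ : σ ∈ faceList k
      σ∈ = ∈-filter⁺ (allPairs? _~?_)
        (subst (λ m → σ ∈ combinations m vertices) (trans (↭-length σ↭τ) s) (∈-combinations⁺ (filter-⊆ (_∈? τ) vertices)))
        (face-↭ (↭-sym σ↭τ) cl)

  -- Together with `restrict`, this identifies coefficient vectors on the listed faces with
  -- alternating chains; `d-extend` and `boundary-restrict` show that the boundary maps correspond.
  extend : ∀ k → (Fin (#faces (Cl G) k) → ℤ) → Function
  extend k a = lincomb a (simplex ∘ faceAt k)

  restrict : ∀ k → Function → Fin (#faces (Cl G) k) → ℤ
  restrict k c i = c (faceAt k i)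

  simplex-chain : ∀ {k σ} → Face k vertices σ → IsChain k vertices (simplex σ)
  simplex-chain {σ = σ} f = chain (simplex-alternating σ) λ τ ¬f → simplex-vanish σ τ λ σ↭τ → ¬f (Face-↭ σ↭τ f)

  extend-chain : ∀ k a → IsChain k vertices (extend k a)
  extend-chain k a = chain-lincomb a (simplex-chain ∘ faceAt-face k)

  restrict-extend : ∀ k a → restrict k (extend k a) ≗ a
  restrict-extend k a j = trans
    (∑-single _ j λ i i≢j → trans
      (cong (a i *_) (simplex-vanish (faceAt k i) (faceAt k j) λ p → i≢j
        (lookup-injective (faces-unique k) i j (↭⇒≡ vertices-unique (faceAt-⊆ k i) (faceAt-⊆ k j) p))))
      (*-zeroʳ (a i)))
    (trans (cong (a j *_) (simplex-self (Unique-⊆ (faceAt-⊆ k j) vertices-unique))) (*-identityʳ (a j)))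

  -- Every face is a permutation of a listed one, and both chains vanish on everything else.
  chain-≗ : ∀ {k c c′} → IsChain k vertices c → IsChain k vertices c′ → restrict k c ≗ restrict k c′ → c ≗ c′
  chain-≗ {k} {c} {c′} C C′ eq τ with length τ ℕ.≟ k ×-dec allPairs? _~?_ τ
  ... | no ¬q = trans (IsChain.support C τ ¬f) (sym (IsChain.support C′ τ ¬f))
    where
    ¬f : ¬ Face k vertices τ
    ¬f (face s _ cl) = ¬q (s , cl)
  ... | yes (s , cl) with i , p ← faceAt-surjective k (face s (All.tabulate (λ {y} _ → vertices-complete y)) cl) =
    alternating-≡ (IsChain.alternating C) (IsChain.alternating C′) p (eq i)

  extend-restrict : ∀ {k c} → IsChain k vertices c → extend k (restrict k c) ≗ c
  extend-restrict {k} {c} C = chain-≗ (extend-chain k (restrict k c)) C (restrict-extend k (restrict k c))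

  boundary-d : ∀ k a → boundary (Cl G) k a ≗ restrict k (d (extend (suc k) a))
  boundary-d k a j = trans
    (sum-cong-≗ λ i → cong (a i *_) (incidence≡d (faceAt-⊆ (suc k) i) (faceAt-⊆ k j)))
    (sym (d-lincomb a (simplex ∘ faceAt (suc k)) (faceAt k j)))

  boundary-restrict : ∀ {k c} → IsChain (suc k) vertices c → boundary (Cl G) k (restrict (suc k) c) ≗ restrict k (d c)
  boundary-restrict {k} {c} C j = trans (boundary-d k (restrict (suc k) c) j)
    (d-cong (extend-restrict C) (faceAt k j))

  d-extend : ∀ k a → d (extend (suc k) a) ≗ extend k (boundary (Cl G) k a)
  d-extend k a = chain-≗ (chain-d (extend-chain (suc k) a)) (extend-chain k (boundary (Cl G) k a)) λ j →
    trans (sym (boundary-d k a j)) (sym (restrict-extend k (boundary (Cl G) k a) j))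

  lincomb-zero : ∀ {r} (a : Fin r → ℤ) (g : Fin r → Function) → (∀ i → a i ≡ 0ℤ) → ∀ τ → lincomb a g τ ≡ 0ℤ
  lincomb-zero a g a≡0 τ = ∑-zero _ λ i → cong (_* g i τ) (a≡0 i)

  extend-cycle : ∀ k a → (∀ i → boundary (Cl G) k a i ≡ 0ℤ) → IsCycle (suc k) vertices (extend (suc k) a)
  extend-cycle k a ∂a≡0 = cycle (extend-chain (suc k) a) λ τ →
    trans (d-extend k a τ) (lincomb-zero (boundary (Cl G) k a) (simplex ∘ faceAt k) ∂a≡0 τ)

  extend-cycle₀ : ∀ a → IsCycle 0 vertices (extend 0 a)
  extend-cycle₀ a = cycle (extend-chain 0 a) λ τ → ∑-zero _ λ i →
    IsChain.support (extend-chain 0 a) (v i ∷ τ) λ { (face () _ _) }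

  -- Subtracting zero is the form that equality with the neutral class takes in the quotient
  -- `homology`.
  exact⇒boundary : ∀ {k} → Exact k vertices → ∀ a → IsCycle k vertices (extend k a) →
                   ∃[ b ] (∀ i → boundary (Cl G) k b i ≡ a i - 0ℤ)
  exact⇒boundary {k} exact a Z with e , E , a≗ ← fill exact Z =
    restrict (suc k) e , λ i → begin
      boundary (Cl G) k (restrict (suc k) e) i  ≡⟨ boundary-restrict E i ⟩
      d e (faceAt k i)                          ≡⟨ a≗ (faceAt k i) ⟨
      restrict k (extend k a) i                 ≡⟨ restrict-extend k a i ⟩
      a i                                       ≡⟨ +-identityʳ (a i) ⟨
      a i - 0ℤ                                  ∎

  -- Degree `i` is spanned by faces with `suc i` vertices and degree -1 by the empty face; below
  -- that the group is trivial by definition.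
  exact⇒trivial : ∀ {s r} → Spherical (suc s) vertices r → ∀ i → i ≢ + s → IsTrivial (H̃ (Cl G) i)
  exact⇒trivial S (+ i) i≢s (a , ∂a≡0) =
    exact⇒boundary (Spherical.exact S (suc i) λ { refl → i≢s refl }) a (extend-cycle i a ∂a≡0)
  exact⇒trivial S -[1+ zero ] _ (a , _) =
    exact⇒boundary (Spherical.exact S 0 λ ()) a (extend-cycle₀ a)
  exact⇒trivial S -[1+ suc i ] _ _ = _

  module _ {s r} (B : Basis (suc s) vertices r) where

    open Basis B

    private
      module H = AbelianGroup (H̃ (Cl G) (+ s))

    lincomb-- : ∀ (a a′ : Fin r → ℤ) τ →
                lincomb (λ i → a i - a′ i) generator τ ≡ lincomb a generator τ - lincomb a′ generator τ
    lincomb-- a a′ τ = trans (sum-cong-≗ λ i → lemma (a i) (a′ i) (generator i τ))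
      (∑-distrib-- (λ i → a i * generator i τ) (λ i → a′ i * generator i τ))
      where
      lemma : ∀ p q x → (p - q) * x ≡ p * x - q * x
      lemma = solve-∀

    lincomb-+ : ∀ (a a′ : Fin r → ℤ) τ →
                lincomb (λ i → a i + a′ i) generator τ ≡ lincomb a generator τ + lincomb a′ generator τ
    lincomb-+ a a′ τ = trans (sum-cong-≗ λ i → lemma (a i) (a′ i) (generator i τ))
      (∑-distrib-+ (λ i → a i * generator i τ) (λ i → a′ i * generator i τ))
      where
      lemma : ∀ p q x → (p + q) * x ≡ p * x + q * x
      lemma = solve-∀

    Represented : Function → (Fin r → ℤ) → Set
    Represented = Represents (suc s) vertices generator

    represented-+ : ∀ {c c′ a a′} → Represented c a → Represented c′ a′ → Represented (λ τ → c τ + c′ τ) (λ i → a i + a′ i)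
    represented-+ {c} {c′} {a} {a′} (represents e E c≗) (represents e′ E′ c′≗) = represents (λ τ → e τ + e′ τ) (chain-+ E E′) λ τ → begin
      c τ + c′ τ
        ≡⟨ cong₂ _+_ (c≗ τ) (c′≗ τ) ⟩
      (lincomb a generator τ + d e τ) + (lincomb a′ generator τ + d e′ τ)
        ≡⟨ lemma (lincomb a generator τ) (d e τ) (lincomb a′ generator τ) (d e′ τ) ⟩
      (lincomb a generator τ + lincomb a′ generator τ) + (d e τ + d e′ τ)
        ≡⟨ cong₂ _+_ (lincomb-+ a a′ τ) (d-+ e e′ τ) ⟨
      lincomb (λ i → a i + a′ i) generator τ + d (λ ρ → e ρ + e′ ρ) τ
        ∎
      where
      lemma : ∀ p q p′ q′ → (p + q) + (p′ + q′) ≡ (p + p′) + (q + q′)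
      lemma = solve-∀

    -- The difference of the two representations is a relation among the generators modulo
    -- boundaries, so independence applies. Well-definedness and additivity of the coordinates both
    -- come from here.
    represented-unique : ∀ {c c′ a a′} → Represented c a → Represented c′ a′ →
                         ∀ e″ → IsChain (suc (suc s)) vertices e″ → (∀ τ → c τ - c′ τ ≡ d e″ τ) → a ≗ a′
    represented-unique {c} {c′} {a} {a′} (represents e E c≗) (represents e′ E′ c′≗) e″ E″ eq i =
      i-j≡0⇒i≡j (a i) (a′ i) (independent (λ i → a i - a′ i) (λ τ → (e τ - e′ τ) - e″ τ) (chain-- (chain-- E E′) E″)
        (λ τ → begin
          lincomb (λ i → a i - a′ i) generator τ + d (λ ρ → (e ρ - e′ ρ) - e″ ρ) τ
            ≡⟨ cong₂ _+_ (lincomb-- a a′ τ) (trans (d-- (λ ρ → e ρ - e′ ρ) e″ τ) (cong₂ _-_ (d-- e e′ τ) (sym (eq τ)))) ⟩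
          (lincomb a generator τ - lincomb a′ generator τ) + ((d e τ - d e′ τ) - (c τ - c′ τ))
            ≡⟨ cong (λ □ → (lincomb a generator τ - lincomb a′ generator τ) + ((d e τ - d e′ τ) - □)) (cong₂ _-_ (c≗ τ) (c′≗ τ)) ⟩
          (lincomb a generator τ - lincomb a′ generator τ) + ((d e τ - d e′ τ) -
            ((lincomb a generator τ + d e τ) - (lincomb a′ generator τ + d e′ τ)))
            ≡⟨ lemma (lincomb a generator τ) (d e τ) (lincomb a′ generator τ) (d e′ τ) ⟩
          0ℤ ∎) i)
      where
      lemma : ∀ p q p′ q′ → (p - p′) + ((q - q′) - ((p + q) - (p′ + q′))) ≡ 0ℤ
      lemma = solve-∀

    extension : H.Carrier → Function
    extension (x , _) = extend (suc s) x

    coordinates : H.Carrier → Fin r → ℤ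
    coordinates (x , ∂x≡0) = proj₁ (spans (extend (suc s) x) (extend-cycle s x ∂x≡0))

    represented : ∀ z → Represented (extension z) (coordinates z)
    represented (x , ∂x≡0) = proj₂ (spans (extend (suc s) x) (extend-cycle s x ∂x≡0))

    extend-- : ∀ (x y : Fin (#faces (Cl G) (suc s)) → ℤ) τ →
               extend (suc s) (λ i → x i - y i) τ ≡ extend (suc s) x τ - extend (suc s) y τ
    extend-- x y = chain-≗ (extend-chain (suc s) (λ i → x i - y i)) (chain-- (extend-chain (suc s) x) (extend-chain (suc s) y)) λ i →
      trans (restrict-extend (suc s) (λ i → x i - y i) i)
        (sym (cong₂ _-_ (restrict-extend (suc s) x i) (restrict-extend (suc s) y i)))

    extend-+ : ∀ (x y : Fin (#faces (Cl G) (suc s)) → ℤ) τ →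
               extend (suc s) (λ i → x i + y i) τ ≡ extend (suc s) x τ + extend (suc s) y τ
    extend-+ x y = chain-≗ (extend-chain (suc s) (λ i → x i + y i)) (chain-+ (extend-chain (suc s) x) (extend-chain (suc s) y)) λ i →
      trans (restrict-extend (suc s) (λ i → x i + y i) i)
        (sym (cong₂ _+_ (restrict-extend (suc s) x i) (restrict-extend (suc s) y i)))

    coordinates-unique : ∀ z {a} → Represented (extension z) a → coordinates z ≗ a
    coordinates-unique z R = represented-unique (represented z) R (λ _ → 0ℤ) zero-chain
      λ τ → trans (+-inverseʳ (extension z τ)) (sym (d-zero (λ _ → 0ℤ) (λ _ → refl) τ))

    coordinates-cong : ∀ {z z′} → z H.≈ z′ → coordinates z ≗ coordinates z′
    coordinates-cong {z@(x , _)} {z′@(x′ , _)} (b , ∂b≡) = represented-unique (represented z) (represented z′)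
      (extend (suc (suc s)) b) (extend-chain (suc (suc s)) b) λ τ → begin
        extend (suc s) x τ - extend (suc s) x′ τ      ≡⟨ extend-- x x′ τ ⟨
        extend (suc s) (λ i → x i - x′ i) τ           ≡⟨ sum-cong-≗ (λ i → cong (_* simplex (faceAt (suc s) i) τ) (∂b≡ i)) ⟨
        extend (suc s) (boundary (Cl G) (suc s) b) τ  ≡⟨ d-extend (suc s) b τ ⟨
        d (extend (suc (suc s)) b) τ                  ∎

    coordinates-homo : ∀ z z′ i → coordinates (z H.∙ z′) i ≡ coordinates z i + coordinates z′ i
    coordinates-homo z@(x , _) z′@(x′ , _) = coordinates-unique (z H.∙ z′) represented-sum
      where
      represented-sum : Represented (extension (z H.∙ z′)) (λ i → coordinates z i + coordinates z′ i)
      represented-sum = relabel (represented-+ (represented z) (represented z′))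
        where
        relabel : ∀ {a} → Represented (λ τ → extension z τ + extension z′ τ) a → Represented (extension (z H.∙ z′)) a
        relabel (represents e E eq) = represents e E λ τ → trans (extend-+ x x′ τ) (eq τ)

    coordinates-injective : ∀ {z z′} → coordinates z ≗ coordinates z′ → z H.≈ z′
    coordinates-injective {z@(x , _)} {z′@(x′ , _)} eq = bounds (represented z) (represented z′)
      where
      σ = faceAt (suc s)
      lemma : ∀ p q r → (p + q) - (p + r) ≡ q - r
      lemma = solve-∀
      bounds : Represented (extension z) (coordinates z) → Represented (extension z′) (coordinates z′) → z H.≈ z′
      bounds (represents e E z≗) (represents e′ E′ z′≗) =
        restrict (suc (suc s)) (λ τ → e τ - e′ τ) , λ i → begin
          boundary (Cl G) (suc s) (restrict (suc (suc s)) (λ τ → e τ - e′ τ)) i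
            ≡⟨ boundary-restrict (chain-- E E′) i ⟩
          d (λ τ → e τ - e′ τ) (σ i)
            ≡⟨ d-- e e′ (σ i) ⟩
          d e (σ i) - d e′ (σ i)
            ≡⟨ lemma (lincomb (coordinates z′) generator (σ i)) (d e (σ i)) (d e′ (σ i)) ⟨
          (lincomb (coordinates z′) generator (σ i) + d e (σ i)) - (lincomb (coordinates z′) generator (σ i) + d e′ (σ i))
            ≡⟨ cong₂ _-_ (trans (z≗ (σ i)) (cong (λ □ → □ + d e (σ i))
                 (sum-cong-≗ λ j → cong (_* generator j (σ i)) (eq j)))) (z′≗ (σ i)) ⟨
          restrict (suc s) (extension z) i - restrict (suc s) (extension z′) i
            ≡⟨ cong₂ _-_ (restrict-extend (suc s) x i) (restrict-extend (suc s) x′ i) ⟩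
          x i - x′ i
            ∎

    coordinates-surjective : ∀ a → ∃[ z ] coordinates z ≗ a
    coordinates-surjective a = z , coordinates-unique z
      (represents (λ _ → 0ℤ) zero-chain λ τ → begin
        extend (suc s) (restrict (suc s) c) τ  ≡⟨ extend-restrict (IsCycle.isChain C) τ ⟩
        c τ                                    ≡⟨ +-identityʳ (c τ) ⟨
        c τ + 0ℤ                               ≡⟨ cong (λ □ → c τ + □) (d-zero (λ _ → 0ℤ) (λ _ → refl) τ) ⟨
        c τ + d (λ _ → 0ℤ) τ                   ∎)
      where
      c = lincomb a generator
      C = cycle-lincomb a isCycle
      z : H.Carrier
      z = restrict (suc s) c , λ i → trans (boundary-restrict (IsCycle.isChain C) i) (IsCycle.closed C (faceAt s i))

    coordinate-map : H̃ (Cl G) (+ s) ⟶ ℤ^ r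
    coordinate-map = additive⇒⟶ (H̃ (Cl G) (+ s)) (ℤ^ r) coordinates
      (λ {z} {z′} → coordinates-cong {z} {z′}) coordinates-homo

    basis⇒≅ : H̃ (Cl G) (+ s) ≅ ℤ^ r
    basis⇒≅ = coordinates , record
      { isGroupMonomorphism = record
        { isGroupHomomorphism = GroupHomomorphism.isGroupHomomorphism coordinate-map
        ; injective = λ {z} {z′} → coordinates-injective {z} {z′}
        }
      ; surjective = λ a → proj₁ (coordinates-surjective a) , λ {z} z≈ i →
          trans (coordinates-cong {z} {proj₁ (coordinates-surjective a)} z≈ i) (proj₂ (coordinates-surjective a) i)
      }

  module _ {xs r} (xs↭ : xs ↭ vertices) (D : Decomposable 3 xs r) where

    -- In `euler` the empty clique supplies 1 and the other terms are those of `χ` with the opposite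
    -- sign, while the decomposition evaluates the sum to (-1)³ times `r`.
    rank≡χ-1 : + r ≡ χ (Cl G) - 1ℤ
    rank≡χ-1 = solve (χ (Cl G)) (+ r) (begin
      1ℤ - χ (Cl G)
        ≡⟨ cong (λ □ → 1ℤ + □) (trans (sum-cong-≗ terms) (∑-neg {length vertices} (λ i → -1ℤ ^ toℕ i * + #faces (Cl G) (suc (toℕ i))))) ⟨
      euler (suc (length vertices)) xs
        ≡⟨ decomposable⇒euler D (suc (length vertices)) (s≤s (ℕ.≤-reflexive (↭-length xs↭))) ⟩
      -1ℤ * + r
        ∎)
      where
      terms : ∀ (i : Fin (length vertices)) → -1ℤ * -1ℤ ^ toℕ i * + #cliques (suc (toℕ i)) xs
              ≡ - (-1ℤ ^ toℕ i * + #faces (Cl G) (suc (toℕ i)))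
      terms i = trans (cong (λ m → -1ℤ * -1ℤ ^ toℕ i * + m)
          (trans (#cliques-↭ (suc (toℕ i)) xs↭) (#cliques≡#faces (suc (toℕ i)) vertices)))
        (lemma (-1ℤ ^ toℕ i) (+ #faces (Cl G) (suc (toℕ i))))
        where
        lemma : ∀ p q → -1ℤ * p * q ≡ - (p * q)
        lemma = solve-∀
      solve : ∀ c r → 1ℤ - c ≡ -1ℤ * r → r ≡ c - 1ℤ
      solve c r eq = trans (lemma₁ r) (trans (cong -_ (sym eq)) (lemma₂ c))
        where
        lemma₁ : ∀ r → r ≡ - (-1ℤ * r)
        lemma₁ = solve-∀
        lemma₂ : ∀ c → - (1ℤ - c) ≡ c - 1ℤ
        lemma₂ = solve-∀

    decomposable⇒homology :
      (∀ i → i ≢ + 2 → IsTrivial (H̃ (Cl G) i))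
      × (Σ[ r ∈ ℕ ] (+ r ≡ χ (Cl G) - 1ℤ × (H̃ (Cl G) (+ 2) ≅ (ℤ^ r))))
    decomposable⇒homology = exact⇒trivial S , r , rank≡χ-1 , basis⇒≅ (Spherical.basis S)
      where
      S : Spherical 3 vertices r
      S = spherical-⊆⊇ (λ {y} _ → vertices-complete y) (∈-resp-↭ (↭-sym xs↭))
        (decomposable⇒spherical (Unique-resp-↭ (setoid Vertex) (↭⇒↭ₛ (↭-sym xs↭)) vertices-unique) D)

-- The partition graph

module Diagrams where

  open import Data.Nat.Base using (pred; _+_; _≤_; _<_; _≥_; z≤n; s≤s; s<s⁻¹)
  open import Data.Nat.ListAction using (sum)
  open import Data.Nat.ListAction.Properties using (sum-↭; sum-++)
  open import Data.Nat.Properties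
  open import Data.Nat.Tactic.RingSolver using (solve-∀)

  -- For suitable `g` this is the size of the diagram, the length of a column or the weight, so one
  -- computation tells how a move changes all three.
  total : (ℕ → ℕ) → List ℕ → ℕ
  total g ls = sum (map g ls)

  total-↭ : ∀ g {ls ms} → ls ↭ ms → total g ls ≡ total g ms
  total-↭ g p = sum-↭ (map⁺ g p)

  total-rows : ∀ g → g 0 ≡ 0 → ∀ ls → total g (ls ++ [ 0 ]) ≡ total g ls
  total-rows g g0≡0 ls = begin
    sum (map g (ls ++ [ 0 ]))         ≡⟨ cong sum (map-++ g ls [ 0 ]) ⟩
    sum (map g ls ++ [ g 0 ])         ≡⟨ sum-++ (map g ls) [ g 0 ] ⟩
    total g ls + (g 0 + 0)            ≡⟨ cong (λ □ → total g ls + (□ + 0)) g0≡0 ⟩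
    total g ls + 0                    ≡⟨ +-identityʳ (total g ls) ⟩
    total g ls                        ∎
    where open ≡-Reasoning

  total-filter : ∀ g → g 0 ≡ 0 → ∀ ls → total g (filter (0 <?_) ls) ≡ total g ls
  total-filter g g0≡0 []           = refl
  total-filter g g0≡0 (zero ∷ ls)  = trans (total-filter g g0≡0 ls) (cong (_+ total g ls) (sym g0≡0))
  total-filter g g0≡0 (suc l ∷ ls) = cong (g (suc l) +_) (total-filter g g0≡0 ls)

  total-updateAt : ∀ g {n} (v : Vec ℕ n) i h →
    total g (toList (updateAt v i h)) + g (Vec.lookup v i) ≡ total g (toList v) + g (h (Vec.lookup v i))
  total-updateAt g (x ∷ v) zero    h = lemma (g (h x)) (total g (toList v)) (g x)
    where
    lemma : ∀ a b c → (a + b) + c ≡ (c + b) + a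
    lemma = solve-∀
  total-updateAt g (x ∷ v) (suc i) h = trans (+-assoc (g x) _ _)
    (trans (cong (g x +_) (total-updateAt g v i h)) (sym (+-assoc (g x) _ _)))

  lookup-fromList : ∀ (ls : List ℕ) i → Vec.lookup (fromList ls) i ≡ lookup ls i
  lookup-fromList (x ∷ ls) zero    = refl
  lookup-fromList (x ∷ ls) (suc i) = lookup-fromList ls i

  total-moveCell : ∀ g ls {i j} → i ≢ j →
    total g (moveCell ls i j) + (g (lookup ls i) + g (lookup ls j))
    ≡ total g ls + (g (pred (lookup ls i)) + g (suc (lookup ls j)))
  total-moveCell g ls {i} {j} i≢j = lemma
    (total g (moveCell ls i j)) (g (lookup ls i)) (g (lookup ls j)) (total g (toList u))
    (g (suc (lookup ls j))) (total g ls) (g (pred (lookup ls i)))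
    (subst (λ b → total g (moveCell ls i j) + g b ≡ total g (toList u) + g (suc b)) uⱼ≡lⱼ (total-updateAt g u j suc))
    (subst₂ (λ a l → total g (toList u) + g a ≡ total g l + g (pred a)) (lookup-fromList ls i) (toList∘fromList ls)
      (total-updateAt g (fromList ls) i pred))
    where
    u = updateAt (fromList ls) i pred
    uⱼ≡lⱼ : Vec.lookup u j ≡ lookup ls j
    uⱼ≡lⱼ = trans (lookup∘updateAt′ j i (i≢j ∘ sym) (fromList ls)) (lookup-fromList ls j)
    lemma : ∀ w a b u b′ l a′ → w + b ≡ u + b′ → u + a ≡ l + a′ → w + (a + b) ≡ l + (a′ + b′)
    lemma w a b u b′ l a′ p q = begin
      w + (a + b)    ≡⟨ shuffle₁ w a b ⟩
      (w + b) + a    ≡⟨ cong (_+ a) p ⟩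
      (u + b′) + a   ≡⟨ shuffle₂ u b′ a ⟩
      (u + a) + b′   ≡⟨ cong (_+ b′) q ⟩
      (l + a′) + b′  ≡⟨ +-assoc l a′ b′ ⟩
      l + (a′ + b′)  ∎
      where
      open ≡-Reasoning
      shuffle₁ : ∀ w a b → w + (a + b) ≡ (w + b) + a
      shuffle₁ = solve-∀
      shuffle₂ : ∀ u b a → (u + b) + a ≡ (u + a) + b
      shuffle₂ = solve-∀

  -- g is recovered from its increments h, the only values that the ends of a move contribute.
  total-increment : ∀ (g h : ℕ → ℕ) → g 0 ≡ 0 → (∀ k → g (suc k) ≡ g k + h (suc k)) →
    ∀ ls {i j} {ms} → i ≢ j → 0 < lookup (ls ++ [ 0 ]) i → filter (0 <?_) (moveCell (ls ++ [ 0 ]) i j) ↭ ms →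
    total g ms + h (lookup (ls ++ [ 0 ]) i) ≡ total g ls + h (suc (lookup (ls ++ [ 0 ]) j))
  total-increment g h g0≡0 step ls {i} {j} {ms} i≢j 0<a p = lemma (lookup rs i) (lookup rs j) 0<a (begin
    total g ms + (g (lookup rs i) + g (lookup rs j))
      ≡⟨ cong (_+ (g (lookup rs i) + g (lookup rs j)))
           (trans (total-↭ g (↭-sym p)) (total-filter g g0≡0 (moveCell rs i j))) ⟩
    total g (moveCell rs i j) + (g (lookup rs i) + g (lookup rs j))
      ≡⟨ total-moveCell g rs i≢j ⟩
    total g rs + (g (pred (lookup rs i)) + g (suc (lookup rs j)))
      ≡⟨ cong (_+ (g (pred (lookup rs i)) + g (suc (lookup rs j)))) (total-rows g g0≡0 ls) ⟩
    total g ls + (g (pred (lookup rs i)) + g (suc (lookup rs j)))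
      ∎)
    where
    open ≡-Reasoning
    rs = ls ++ [ 0 ]
    lemma : ∀ a b → 0 < a → total g ms + (g a + g b) ≡ total g ls + (g (pred a) + g (suc b)) →
            total g ms + h a ≡ total g ls + h (suc b)
    lemma (suc a) b _ eq = +-cancelʳ-≡ (g a + g b) _ _ (begin
      (total g ms + h (suc a)) + (g a + g b)  ≡⟨ shuffle₁ (total g ms) (h (suc a)) (g a) (g b) ⟩
      total g ms + ((g a + h (suc a)) + g b)  ≡⟨ cong (λ □ → total g ms + (□ + g b)) (step a) ⟨
      total g ms + (g (suc a) + g b)          ≡⟨ eq ⟩
      total g ls + (g a + g (suc b))          ≡⟨ cong (λ □ → total g ls + (g a + □)) (step b) ⟩
      total g ls + (g a + (g b + h (suc b)))  ≡⟨ shuffle₂ (total g ls) (g a) (g b) (h (suc b)) ⟩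
      (total g ls + h (suc b)) + (g a + g b)  ∎)
      where
      shuffle₁ : ∀ m h a b → (m + h) + (a + b) ≡ m + ((a + h) + b)
      shuffle₁ = solve-∀
      shuffle₂ : ∀ l a b h → l + (a + (b + h)) ≡ (l + h) + (a + b)
      shuffle₂ = solve-∀

  -- Column lengths of a diagram.

  ⟦_≤_⟧ : ℕ → ℕ → ℕ
  ⟦ zero  ≤ x     ⟧ = 1
  ⟦ suc t ≤ zero  ⟧ = 0
  ⟦ suc t ≤ suc x ⟧ = ⟦ t ≤ x ⟧

  ⟦_≡_⟧ : ℕ → ℕ → ℕ
  ⟦ zero  ≡ zero  ⟧ = 1
  ⟦ zero  ≡ suc x ⟧ = 0
  ⟦ suc t ≡ zero  ⟧ = 0
  ⟦ suc t ≡ suc x ⟧ = ⟦ t ≡ x ⟧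

  ⟦≤⟧-split : ∀ t x → ⟦ t ≤ x ⟧ ≡ ⟦ suc t ≤ x ⟧ + ⟦ t ≡ x ⟧
  ⟦≤⟧-split zero    zero    = refl
  ⟦≤⟧-split zero    (suc x) = refl
  ⟦≤⟧-split (suc t) zero    = refl
  ⟦≤⟧-split (suc t) (suc x) = ⟦≤⟧-split t x

  ⟦≤⟧-yes : ∀ {t x} → t ≤ x → ⟦ t ≤ x ⟧ ≡ 1
  ⟦≤⟧-yes z≤n       = refl
  ⟦≤⟧-yes (s≤s t≤x) = ⟦≤⟧-yes t≤x

  ⟦≤⟧-no : ∀ {t x} → x < t → ⟦ t ≤ x ⟧ ≡ 0
  ⟦≤⟧-no (s≤s {m = zero}  _)         = refl
  ⟦≤⟧-no (s≤s {m = suc x} x<t) = ⟦≤⟧-no x<t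

  ⟦≡⟧-refl : ∀ t → ⟦ t ≡ t ⟧ ≡ 1
  ⟦≡⟧-refl zero    = refl
  ⟦≡⟧-refl (suc t) = ⟦≡⟧-refl t

  ⟦≡⟧-≢ : ∀ {t x} → t ≢ x → ⟦ t ≡ x ⟧ ≡ 0
  ⟦≡⟧-≢ {zero}  {zero}  t≢x = contradiction refl t≢x
  ⟦≡⟧-≢ {zero}  {suc x} t≢x = refl
  ⟦≡⟧-≢ {suc t} {zero}  t≢x = refl
  ⟦≡⟧-≢ {suc t} {suc x} t≢x = ⟦≡⟧-≢ (t≢x ∘ cong suc)

  ⟦≤⟧-same : ∀ {t x} → t ≢ x → ⟦ t ≤ x ⟧ ≡ ⟦ suc t ≤ x ⟧
  ⟦≤⟧-same {t} {x} t≢x = trans (⟦≤⟧-split t x) (trans (cong (⟦ suc t ≤ x ⟧ +_) (⟦≡⟧-≢ t≢x)) (+-identityʳ _))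

  -- For t > 0, the length of column t of the diagram.
  column : ℕ → List ℕ → ℕ
  column t = total ⟦ t ≤_⟧

  column-anti : ∀ t ls → column (suc t) ls ≤ column t ls
  column-anti t []       = z≤n
  column-anti t (x ∷ ls) = +-mono-≤ (≤-trans (m≤m+n _ _) (≤-reflexive (sym (⟦≤⟧-split t x)))) (column-anti t ls)

  column-large : ∀ {t x xs} → Linked _≥_ (x ∷ xs) → x < t → column t (x ∷ xs) ≡ 0
  column-large [-]        x<t = cong (_+ 0) (⟦≤⟧-no x<t)
  column-large (x≥y ∷ ds) x<t = cong₂ _+_ (⟦≤⟧-no x<t) (column-large ds (≤-<-trans x≥y x<t))

  column-≤ : ∀ {x y xs ys} → Linked _≥_ (y ∷ ys) → column x (x ∷ xs) ≡ column x (y ∷ ys) → x ≤ y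
  column-≤ {x} {y} {xs} es eq = ≮⇒≥ λ y<x → contradiction
    (trans (sym (column-large es y<x)) (trans (sym eq) (cong (_+ column x xs) (⟦≤⟧-yes (≤-refl {x}))))) λ ()

  -- A column is empty once its index exceeds the first row, so equal columns force equal first
  -- rows; these cancel and the argument recurs.
  columns-injective : ∀ {xs ys} → Linked _≥_ xs → Linked _≥_ ys → All (0 <_) xs → All (0 <_) ys →
                      (∀ t → 0 < t → column t xs ≡ column t ys) → xs ≡ ys
  columns-injective {[]}     {[]}     _ _ _ _ _ = refl
  columns-injective {[]}     {y ∷ ys} _ _ _ (0<y ∷ _) eq =
    contradiction (trans (eq y 0<y) (cong (_+ column y ys) (⟦≤⟧-yes (≤-refl {y})))) λ ()
  columns-injective {x ∷ xs} {[]}     _ _ (0<x ∷ _) _ eq =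
    contradiction (trans (sym (eq x 0<x)) (cong (_+ column x xs) (⟦≤⟧-yes (≤-refl {x})))) λ ()
  columns-injective {x ∷ xs} {y ∷ ys} ds es (0<x ∷ ps) (0<y ∷ qs) eq
    with refl ← ≤-antisym (column-≤ {x} {y} {xs} {ys} es (eq x 0<x)) (column-≤ {y} {x} {ys} {xs} ds (sym (eq y 0<y))) =
    cong (x ∷_) (columns-injective (Linked.tail ds) (Linked.tail es) ps qs λ t 0<t →
    +-cancelˡ-≡ ⟦ t ≤ x ⟧ _ _ (eq t 0<t))

  -- The drop from column `p` to column `suc p` counts the rows of length exactly `p`.
  column-drop⇒∈ : ∀ p ls → column (suc p) ls < column p ls → ∃[ i ] lookup ls i ≡ p
  column-drop⇒∈ p (x ∷ ls) drop with p ≟ x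
  ... | yes refl = zero , refl
  ... | no p≢x with i , eq ← column-drop⇒∈ p ls (+-cancelˡ-< ⟦ suc p ≤ x ⟧ _ _ (subst (λ □ → column (suc p) (x ∷ ls) < □ + column p ls) (⟦≤⟧-same p≢x) drop)) = suc i , eq

  column-drop⇒twice : ∀ p ls → suc (column (suc p) ls) < column p ls →
                      ∃[ i ] ∃[ j ] i ≢ j × lookup ls i ≡ p × lookup ls j ≡ p
  column-drop⇒twice p (x ∷ ls) drop with p ≟ x
  ... | no p≢x with i , j , i≢j , eq , eq′ ← column-drop⇒twice p ls (+-cancelˡ-< ⟦ suc p ≤ x ⟧ _ _
        (subst₂ _<_ (sym (+-suc _ _)) (cong (_+ column p ls) (⟦≤⟧-same p≢x)) drop)) = suc i , suc j , (λ { refl → i≢j refl }) , eq , eq′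
  ... | yes refl with j , eq ← column-drop⇒∈ p ls (s<s⁻¹ (subst₂ _<_ (cong (λ □ → suc (□ + column (suc p) ls)) (⟦≤⟧-no (n<1+n p)))
        (cong (_+ column p ls) (⟦≤⟧-yes (≤-refl {p}))) drop)) = zero , suc j , (λ ()) , refl , eq

  triangle : ℕ → ℕ
  triangle zero    = 0
  triangle (suc k) = triangle k + suc k

  -- Shifts of columns and moves of cells.

  module _ {n : ℕ} where

    weight : Partition n → ℕ
    weight μ = total triangle (parts μ)

    height : ℕ → Partition n → ℕ
    height t μ = column t (parts μ)

    heights-injective : ∀ {μ ν : Partition n} → (∀ t → 0 < t → height t μ ≡ height t ν) → μ ≡ ν
    heights-injective {partition _ d p _} {partition _ d′ p′ _} eq = parts-injective (columns-injective d d′ p p′ eq)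

    -- Removing a cell from column p and adding one to column q turns the diagram of μ into that of ν.
    record Shift (μ ν : Partition n) (p q : ℕ) : Set where
      constructor mkShift
      field
        p≢q     : p ≢ q
        0<p     : 0 < p
        0<q     : 0 < q
        heights : ∀ t → 0 < t → height t ν + ⟦ t ≡ p ⟧ ≡ height t μ + ⟦ t ≡ q ⟧

    open Shift

    shift-sym : ∀ {μ ν p q} → Shift μ ν p q → Shift ν μ q p
    shift-sym (mkShift p≢q 0<p 0<q heights) = mkShift (p≢q ∘ sym) 0<q 0<p λ t 0<t → sym (heights t 0<t)

    -- The cell moves from the row i of length p to the row j of length q - 1.
    Cells : Partition n → ℕ → ℕ → Set
    Cells μ p q = ∃[ i ] ∃[ j ] i ≢ j × lookup (rows μ) i ≡ p × suc (lookup (rows μ) j) ≡ q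

    rows-column : ∀ t → 0 < t → ∀ μ → column t (rows μ) ≡ height t μ
    rows-column (suc t) _ μ = total-rows ⟦ suc t ≤_⟧ refl (parts μ)

    zero-row : ∀ (ls : List ℕ) → ∃[ j ] lookup (ls ++ [ 0 ]) j ≡ 0
    zero-row []       = zero , refl
    zero-row (_ ∷ ls) = let j , eq = zero-row ls in suc j , eq

    rows-drop⇒∈ : ∀ μ p → 0 < p → height (suc p) μ < height p μ → ∃[ i ] lookup (rows μ) i ≡ p
    rows-drop⇒∈ μ p 0<p drop = column-drop⇒∈ p (rows μ)
      (subst₂ _<_ (sym (rows-column (suc p) (s≤s z≤n) μ)) (sym (rows-column p 0<p μ)) drop)

    -- Column `suc p` does not get longer when it passes to `μ`, column `p` does, and in `ν` they
    -- are weakly decreasing; so in `μ` they drop strictly.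
    shift⇒row : ∀ {μ ν p q} → Shift μ ν p q → ∃[ i ] lookup (rows μ) i ≡ p
    shift⇒row {μ} {ν} {p} {q} (mkShift p≢q 0<p 0<q heights) = rows-drop⇒∈ μ p 0<p (begin-strict
      height (suc p) μ                         ≤⟨ m≤m+n _ ⟦ suc p ≡ q ⟧ ⟩
      height (suc p) μ + ⟦ suc p ≡ q ⟧         ≡⟨ heights (suc p) (s≤s z≤n) ⟨
      height (suc p) ν + ⟦ suc p ≡ p ⟧         ≡⟨ cong (height (suc p) ν +_) (⟦≡⟧-≢ (1+n≢n {p})) ⟩
      height (suc p) ν + 0                     ≡⟨ +-identityʳ _ ⟩
      height (suc p) ν                         ≤⟨ column-anti p (parts ν) ⟩
      height p ν                               <⟨ m<m+n (height p ν) (s≤s z≤n) ⟩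
      height p ν + 1                           ≡⟨ cong (height p ν +_) (⟦≡⟧-refl p) ⟨
      height p ν + ⟦ p ≡ p ⟧                   ≡⟨ heights p 0<p ⟩
      height p μ + ⟦ p ≡ q ⟧                   ≡⟨ cong (height p μ +_) (⟦≡⟧-≢ p≢q) ⟩
      height p μ + 0                           ≡⟨ +-identityʳ _ ⟩
      height p μ                               ∎)
      where open ≤-Reasoning

    -- A receiving row of length `q - 1` exists because column `q` must still fit under the previous
    -- one after it grows; for `q = 1` it is the empty row. If `q - 1 = p`, giving and receiving
    -- rows have equal length and must differ, hence the extra bracket in `drop`, which yields two
    -- such rows.
    shift⇒cells : ∀ {μ ν p q} → Shift μ ν p q → Cells μ p q
    shift⇒cells {μ} {ν} {p} {suc zero} S with i , eq ← shift⇒row S | j , eq′ ← zero-row (parts μ) =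
      i , j , (λ { refl → <⇒≢ (0<p S) (trans (sym eq′) eq) }) , eq , cong suc eq′
    shift⇒cells {μ} {ν} {p} {suc r@(suc _)} S = cells (r ≟ p)
      where
      open ≤-Reasoning
      drop : suc (height (suc r) μ) + ⟦ r ≡ p ⟧ ≤ height r μ
      drop = begin
        suc (height (suc r) μ) + ⟦ r ≡ p ⟧             ≡⟨ cong (_+ ⟦ r ≡ p ⟧) (+-comm 1 (height (suc r) μ)) ⟩
        height (suc r) μ + 1 + ⟦ r ≡ p ⟧               ≡⟨ cong (λ □ → height (suc r) μ + □ + ⟦ r ≡ p ⟧) (⟦≡⟧-refl (suc r)) ⟨
        height (suc r) μ + ⟦ suc r ≡ suc r ⟧ + ⟦ r ≡ p ⟧ ≡⟨ cong (_+ ⟦ r ≡ p ⟧) (heights S (suc r) (s≤s z≤n)) ⟨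
        height (suc r) ν + ⟦ suc r ≡ p ⟧ + ⟦ r ≡ p ⟧   ≡⟨ cong (λ □ → height (suc r) ν + □ + ⟦ r ≡ p ⟧) (⟦≡⟧-≢ (p≢q S ∘ sym)) ⟩
        height (suc r) ν + 0 + ⟦ r ≡ p ⟧               ≡⟨ cong (_+ ⟦ r ≡ p ⟧) (+-identityʳ (height (suc r) ν)) ⟩
        height (suc r) ν + ⟦ r ≡ p ⟧                   ≤⟨ +-monoˡ-≤ ⟦ r ≡ p ⟧ (column-anti r (parts ν)) ⟩
        height r ν + ⟦ r ≡ p ⟧                         ≡⟨ heights S r (s≤s z≤n) ⟩
        height r μ + ⟦ r ≡ suc r ⟧                     ≡⟨ cong (height r μ +_) (⟦≡⟧-≢ (1+n≢n {r} ∘ sym)) ⟩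
        height r μ + 0                                 ≡⟨ +-identityʳ (height r μ) ⟩
        height r μ                                     ∎
      cells : Dec (r ≡ p) → Cells μ p (suc r)
      cells (no r≢p) with i , eq ← shift⇒row S | j , eq′ ← rows-drop⇒∈ μ r (s≤s z≤n) (≤-trans (m≤m+n _ ⟦ r ≡ p ⟧) drop) =
        i , j , (λ { refl → r≢p (trans (sym eq′) eq) }) , eq , cong suc eq′
      cells (yes refl) with i , j , i≢j , eq , eq′ ← column-drop⇒twice r (rows μ) (begin-strict
          suc (column (suc r) (rows μ))        ≡⟨ cong suc (rows-column (suc r) (s≤s z≤n) μ) ⟩
          suc (height (suc r) μ)               <⟨ m<m+n _ (s≤s z≤n) ⟩
          suc (height (suc r) μ) + 1           ≡⟨ cong (suc (height (suc r) μ) +_) (⟦≡⟧-refl r) ⟨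
          suc (height (suc r) μ) + ⟦ r ≡ r ⟧   ≤⟨ drop ⟩
          height r μ                           ≡⟨ rows-column r (s≤s z≤n) μ ⟨
          column r (rows μ)                    ∎) = i , j , i≢j , eq , cong suc eq′

    module _ {μ ν : Partition n} (move : Move μ ν) where

      private
        i = proj₁ move
        j = proj₁ (proj₂ move)
        i≢j = proj₁ (proj₂ (proj₂ move))
        0<a = proj₁ (proj₂ (proj₂ (proj₂ move)))
        perm = proj₂ (proj₂ (proj₂ (proj₂ move)))

      move-heights : ∀ t → 0 < t → height t ν + ⟦ t ≡ lookup (rows μ) i ⟧ ≡ height t μ + ⟦ t ≡ suc (lookup (rows μ) j) ⟧
      move-heights (suc t) _ = total-increment ⟦ suc t ≤_⟧ ⟦ suc t ≡_⟧ refl (⟦≤⟧-split t) (parts μ) i≢j 0<a perm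

      move-weight : weight ν + lookup (rows μ) i ≡ weight μ + suc (lookup (rows μ) j)
      move-weight = total-increment triangle id refl (λ _ → refl) (parts μ) i≢j 0<a perm

      move⇒shift : μ ≢ ν → Shift μ ν (lookup (rows μ) i) (suc (lookup (rows μ) j))
      move⇒shift μ≢ν = mkShift
        -- If the two columns coincide, the move just exchanges two row lengths and every column
        -- stays as it was.
        (λ a≡b → μ≢ν (heights-injective λ t 0<t → sym (+-cancelʳ-≡ ⟦ t ≡ lookup (rows μ) i ⟧ _ _
          (trans (move-heights t 0<t) (cong (λ □ → height t μ + ⟦ t ≡ □ ⟧) (sym a≡b))))))
        0<a (s≤s z≤n) move-heights

    cells⇒move : ∀ {μ p q} → 0 < p → ((i , j , _) : Cells μ p q) → ∃[ ν ] Σ[ m ∈ Move μ ν ] proj₁ m ≡ i × proj₁ (proj₂ m) ≡ j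
    cells⇒move {μ} {p} {q} 0<p (i , j , i≢j , refl , _) =
      partition (sort ≥-decTotalOrder new) (sort-↗ ≥-decTotalOrder new) (All-resp-↭ (↭-sym new↭) (all-filter (0 <?_) (moveCell (rows μ) i j)))
        (trans (sum-↭ new↭) size) ,
      (i , j , i≢j , 0<p , ↭-sym new↭) , refl , refl
      where
      ≥-decTotalOrder = converse ≤-decTotalOrder
      new = filter (0 <?_) (moveCell (rows μ) i j)
      new↭ = sort-↭ ≥-decTotalOrder new
      map-id′ : ∀ ls → total id ls ≡ sum ls
      map-id′ []       = refl
      map-id′ (l ∷ ls) = cong (l +_) (map-id′ ls)
      size : sum new ≡ n
      size = +-cancelʳ-≡ 1 _ _ (begin
        sum new + 1              ≡⟨ cong (_+ 1) (map-id′ new) ⟨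
        -- The increments of `id` are constantly 1, so the cell taken away and the cell put back
        -- cancel.
        total id new + 1         ≡⟨ total-increment id (λ _ → 1) refl (λ k → +-comm 1 k) (parts μ) i≢j 0<p ↭-refl ⟩
        total id (parts μ) + 1   ≡⟨ cong (_+ 1) (trans (map-id′ (parts μ)) (Partition.sum≡n μ)) ⟩
        n + 1                    ∎)
        where open ≡-Reasoning

    cells⇒shift : ∀ {μ p q} → 0 < p → p ≢ q → Cells μ p q → ∃[ ν ] Move μ ν × Shift μ ν p q × weight ν + p ≡ weight μ + q
    cells⇒shift {μ} 0<p p≢q C@(i , j , i≢j , refl , refl) with ν , m , refl , refl ← cells⇒move {μ} 0<p C =
      ν , m , mkShift p≢q 0<p (s≤s z≤n) (move-heights {μ} {ν} m) , move-weight {μ} {ν} m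

    shift-unique : ∀ {μ ν ν′ p q} → Shift μ ν p q → Shift μ ν′ p q → ν ≡ ν′
    shift-unique S S′ = heights-injective λ t 0<t →
      +-cancelʳ-≡ ⟦ t ≡ _ ⟧ _ _ (trans (heights S t 0<t) (sym (heights S′ t 0<t)))

    -- Moving the cell found by `shift⇒cells` gives a partition with the columns of `ν`, hence `ν`
    -- itself.
    shift⇒move : ∀ {μ ν p q} → Shift μ ν p q → Move μ ν × weight ν + p ≡ weight μ + q
    shift⇒move S with ν′ , m , S′ , w ← cells⇒shift (0<p S) (p≢q S) (shift⇒cells S) with refl ← shift-unique S S′ = m , w

    shift-≢ : ∀ {μ ν p q} → Shift μ ν p q → μ ≢ ν
    shift-≢ {p = p} (mkShift p≢q 0<p _ heights) refl = contradiction
      (trans (sym (⟦≡⟧-refl p)) (trans (+-cancelˡ-≡ _ _ _ (heights p 0<p)) (⟦≡⟧-≢ p≢q))) λ ()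

    shift⇒adjacent : ∀ {μ ν p q} → Shift μ ν p q → Adjacent μ ν
    shift⇒adjacent S = shift-≢ S , inj₁ (proj₁ (shift⇒move S))

    shift-weight : ∀ {μ ν p q} → Shift μ ν p q → weight ν + p ≡ weight μ + q
    shift-weight S = proj₂ (shift⇒move S)

    adjacent⇒shift : ∀ {μ ν} → Adjacent μ ν → ∃[ p ] ∃[ q ] Shift μ ν p q
    adjacent⇒shift (μ≢ν , inj₁ m) = _ , _ , move⇒shift m μ≢ν
    adjacent⇒shift (μ≢ν , inj₂ m) = _ , _ , shift-sym (move⇒shift m (μ≢ν ∘ sym))

  -- Superadditivity of triangular numbers.

  triangle-+ : ∀ m k → triangle m + triangle k ≤ triangle (m + k)
  triangle-+ m zero    = ≤-reflexive (trans (+-identityʳ (triangle m)) (cong triangle (sym (+-identityʳ m))))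
  triangle-+ m (suc k) = begin
    triangle m + (triangle k + suc k)  ≡⟨ +-assoc (triangle m) (triangle k) (suc k) ⟨
    (triangle m + triangle k) + suc k  ≤⟨ +-mono-≤ (triangle-+ m k) (s≤s (m≤n+m k m)) ⟩
    triangle (m + k) + suc (m + k)     ≡⟨ cong triangle (+-suc m k) ⟨
    triangle (m + suc k)               ∎
    where open ≤-Reasoning

  -- Cutting a row into two nonempty rows lowers the weight strictly, so the one-row partition is
  -- the only heaviest one.
  triangle-+-< : ∀ {m k} → 0 < m → 0 < k → triangle m + triangle k < triangle (m + k)
  triangle-+-< {m} {suc k} 0<m _ = begin-strict
    triangle m + (triangle k + suc k)  ≡⟨ +-assoc (triangle m) (triangle k) (suc k) ⟨
    (triangle m + triangle k) + suc k  <⟨ +-mono-≤-< (triangle-+ m k) (s≤s (m<n+m k 0<m)) ⟩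
    triangle (m + k) + suc (m + k)     ≡⟨ cong triangle (+-suc m k) ⟨
    triangle (m + suc k)               ∎
    where open ≤-Reasoning

  total-triangle : ∀ ls → total triangle ls ≤ triangle (sum ls)
  total-triangle []       = z≤n
  total-triangle (l ∷ ls) = ≤-trans (+-monoʳ-≤ (triangle l) (total-triangle ls)) (triangle-+ l (sum ls))

  -- Adjacency and weights among the shifts of a fixed partition.

  module _ {n : ℕ} where

    open FiniteGraph (G n) using (_~_; _~?_; ~-sym; ~-irrefl)
    open CliqueHomology (G n) using (lk)
    open Counting (G n)
    open Shift

    -- Let `y` become `z` by the shift (a , b). Going from `l` to `z` through `y` must have the same
    -- effect as going directly, so the multisets of columns a, p, q′ and b, p′, q agree, which is
    -- impossible if neither column is shared.
    shifts-share : ∀ {l y z : Partition n} {p q p′ q′} → Shift l y p q → p < q → Shift l z p′ q′ → p′ < q′ → y ~ z →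
                   p ≡ p′ ⊎ q ≡ q′
    shifts-share {l} {y} {z} {p} {q} {p′} {q′} S p<q S′ p′<q′ y~z with adjacent⇒shift y~z
    ... | a , b , T with p ≟ p′ | q ≟ q′
    ...   | yes p≡p′ | _        = inj₁ p≡p′
    ...   | no _     | yes q≡q′ = inj₂ q≡q′
    ...   | no p≢p′  | no q≢q′  = contradiction at-b 2≢1
      where
      open ≡-Reasoning
      -- Comparing both sides at p and at q′ forces p ≡ b ≡ q′, and then they differ at b.
      balance : ∀ t → 0 < t → ⟦ t ≡ a ⟧ + (⟦ t ≡ p ⟧ + ⟦ t ≡ q′ ⟧) ≡ ⟦ t ≡ b ⟧ + (⟦ t ≡ p′ ⟧ + ⟦ t ≡ q ⟧)
      balance t 0<t = +-cancelˡ-≡ (height t z + height t y + height t l) _ _ (begin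
        (height t z + height t y + height t l) + (⟦ t ≡ a ⟧ + (⟦ t ≡ p ⟧ + ⟦ t ≡ q′ ⟧))
          ≡⟨ shuffle₁ (height t z) (height t y) (height t l) ⟦ t ≡ a ⟧ ⟦ t ≡ p ⟧ ⟦ t ≡ q′ ⟧ ⟩
        (height t z + ⟦ t ≡ a ⟧) + (height t y + ⟦ t ≡ p ⟧) + (height t l + ⟦ t ≡ q′ ⟧)
          ≡⟨ cong₂ _+_ (cong₂ _+_ (heights T t 0<t) (heights S t 0<t)) (sym (heights S′ t 0<t)) ⟩
        (height t y + ⟦ t ≡ b ⟧) + (height t l + ⟦ t ≡ q ⟧) + (height t z + ⟦ t ≡ p′ ⟧)
          ≡⟨ shuffle₂ (height t z) (height t y) (height t l) ⟦ t ≡ b ⟧ ⟦ t ≡ p′ ⟧ ⟦ t ≡ q ⟧ ⟩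
        (height t z + height t y + height t l) + (⟦ t ≡ b ⟧ + (⟦ t ≡ p′ ⟧ + ⟦ t ≡ q ⟧))
          ∎)
        where
        shuffle₁ : ∀ z y l a p q → (z + y + l) + (a + (p + q)) ≡ (z + a) + (y + p) + (l + q)
        shuffle₁ = solve-∀
        shuffle₂ : ∀ z y l b p q → (y + b) + (l + q) + (z + p) ≡ (z + y + l) + (b + (p + q))
        shuffle₂ = solve-∀
      p≡b : p ≡ b
      p≡b with p ≟ b
      ... | yes p≡b = p≡b
      ... | no p≢b  = contradiction (balance p (0<p S)) (λ eq → contradiction
        (trans (sym (cong (λ □ → ⟦ p ≡ a ⟧ + (□ + ⟦ p ≡ q′ ⟧)) (⟦≡⟧-refl p)))
          (trans eq (cong₂ _+_ (⟦≡⟧-≢ p≢b) (cong₂ _+_ (⟦≡⟧-≢ p≢p′) (⟦≡⟧-≢ (<⇒≢ p<q)))))) (pos ⟦ p ≡ a ⟧ _))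
        where
        pos : ∀ u w → u + (1 + w) ≢ 0
        pos zero    w ()
        pos (suc u) w ()
      q′≡b : q′ ≡ b
      q′≡b with q′ ≟ b
      ... | yes q′≡b = q′≡b
      ... | no q′≢b  = contradiction (balance q′ (0<q S′)) (λ eq → contradiction
        (trans (sym (cong (λ □ → ⟦ q′ ≡ a ⟧ + (⟦ q′ ≡ p ⟧ + □)) (⟦≡⟧-refl q′)))
          (trans eq (cong₂ _+_ (⟦≡⟧-≢ q′≢b) (cong₂ _+_ (⟦≡⟧-≢ (<⇒≢ p′<q′ ∘ sym)) (⟦≡⟧-≢ (q≢q′ ∘ sym))))))
        (pos ⟦ q′ ≡ a ⟧ _))
        where
        pos : ∀ u w → u + (w + 1) ≢ 0
        pos zero    zero    ()
        pos zero    (suc w) ()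
        pos (suc u) w       ()
      2≢1 : 2 ≢ 1
      2≢1 ()
      at-b : 2 ≡ 1
      at-b = begin
        0 + (1 + 1)
          ≡⟨ cong₂ _+_ (⟦≡⟧-≢ (p≢q T ∘ sym)) (cong₂ _+_ (trans (cong ⟦ b ≡_⟧ p≡b) (⟦≡⟧-refl b)) (trans (cong ⟦ b ≡_⟧ q′≡b) (⟦≡⟧-refl b))) ⟨
        ⟦ b ≡ a ⟧ + (⟦ b ≡ p ⟧ + ⟦ b ≡ q′ ⟧)
          ≡⟨ balance b (subst (0 <_) p≡b (0<p S)) ⟩
        ⟦ b ≡ b ⟧ + (⟦ b ≡ p′ ⟧ + ⟦ b ≡ q ⟧)
          ≡⟨ cong₂ _+_ (⟦≡⟧-refl b) (cong₂ _+_ (⟦≡⟧-≢ λ b≡p′ → p≢p′ (trans p≡b b≡p′))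
               (⟦≡⟧-≢ λ b≡q → q≢q′ (trans (sym b≡q) (sym q′≡b)))) ⟩
        1 + (0 + 0)
          ∎

    shift-target : ∀ {l y z : Partition n} {p p′ q} → Shift l y p q → Shift l z p′ q → p ≢ p′ → Shift y z p′ p
    shift-target {l} {y} {z} {p} {p′} {q} S S′ p≢p′ = mkShift (p≢p′ ∘ sym) (0<p S′) (0<p S) λ t 0<t →
      trans (heights S′ t 0<t) (sym (heights S t 0<t))

    shift-source : ∀ {l y z : Partition n} {p q q′} → Shift l y p q → Shift l z p q′ → q ≢ q′ → Shift y z q q′
    shift-source {l} {y} {z} {p} {q} {q′} S S′ q≢q′ = mkShift q≢q′ (0<q S) (0<q S′) λ t 0<t →
      +-cancelˡ-≡ (height t l + ⟦ t ≡ p ⟧) _ _ (begin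
        (height t l + ⟦ t ≡ p ⟧) + (height t z + ⟦ t ≡ q ⟧)  ≡⟨ shuffle (height t l) ⟦ t ≡ p ⟧ (height t z) ⟦ t ≡ q ⟧ ⟩
        (height t z + ⟦ t ≡ p ⟧) + (height t l + ⟦ t ≡ q ⟧)  ≡⟨ cong₂ _+_ (heights S′ t 0<t) (sym (heights S t 0<t)) ⟩
        (height t l + ⟦ t ≡ q′ ⟧) + (height t y + ⟦ t ≡ p ⟧) ≡⟨ shuffle′ (height t l) ⟦ t ≡ q′ ⟧ (height t y) ⟦ t ≡ p ⟧ ⟩
        (height t l + ⟦ t ≡ p ⟧) + (height t y + ⟦ t ≡ q′ ⟧) ∎)
      where
      open ≡-Reasoning
      shuffle : ∀ l p z q → (l + p) + (z + q) ≡ (z + p) + (l + q)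
      shuffle = solve-∀
      shuffle′ : ∀ l q y p → (l + q) + (y + p) ≡ (l + p) + (y + q)
      shuffle′ = solve-∀

    -- The row losing the cell is taken from one shift and the row gaining it from the other. Their
    -- lengths `p′` and `q - 1` differ by hypothesis, so they are different rows.
    shift-mix : ∀ {l y z : Partition n} {p q p′ q′} → Shift l y p q → Shift l z p′ q′ → suc p′ < q →
                ∃[ w ] Shift l w p′ q
    shift-mix {l} S S′ 1+p′<q with _ , j , _ , _ , eqⱼ ← shift⇒cells S | i , eqᵢ ← shift⇒row S′ =
      let w , _ , T , _ = cells⇒shift (0<p S′) (<⇒≢ (<-trans (n<1+n _) 1+p′<q))
            (i , j , (λ { refl → <⇒≢ 1+p′<q (trans (cong suc (sym eqᵢ)) eqⱼ) }) , eqᵢ , eqⱼ) in w , T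

    shift-up : ∀ {μ ν : Partition n} {p q} → Shift μ ν p q → weight μ ≤ weight ν → p < q
    shift-up {μ} {ν} {p} {q} S w≤ = ≤∧≢⇒< (+-cancelˡ-≤ (weight μ) _ _
      (≤-trans (+-monoˡ-≤ p w≤) (≤-reflexive (shift-weight S)))) (p≢q S)

    -- The conclusion is q - p ≤ q′ - p′ without subtraction, each side being the weight gained over
    -- `l`.
    shift-compare : ∀ {l y z : Partition n} {p q p′ q′} → Shift l y p q → Shift l z p′ q′ → weight y ≤ weight z → q + p′ ≤ q′ + p
    shift-compare {l} {y} {z} {p} {q} {p′} {q′} S S′ y≤z = +-cancelˡ-≤ (weight l) _ _ (begin
      weight l + (q + p′)   ≡⟨ +-assoc (weight l) q p′ ⟨
      (weight l + q) + p′   ≡⟨ cong (_+ p′) (shift-weight S) ⟨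
      (weight y + p) + p′   ≤⟨ +-monoˡ-≤ p′ (+-monoˡ-≤ p y≤z) ⟩
      (weight z + p) + p′   ≡⟨ shuffle (weight z) p p′ ⟩
      (weight z + p′) + p   ≡⟨ cong (_+ p) (shift-weight S′) ⟩
      (weight l + q′) + p   ≡⟨ +-assoc (weight l) q′ p ⟩
      weight l + (q′ + p)   ∎)
      where
      open ≤-Reasoning
      shuffle : ∀ z p q → (z + p) + q ≡ (z + q) + p
      shuffle = solve-∀

    weight-<ˡ : ∀ {l y z : Partition n} {p p′ q} → Shift l y p q → Shift l z p′ q → p′ < p → weight y < weight z
    weight-<ˡ {l} {y} {z} {p} {p′} {q} S S′ p′<p = +-cancelʳ-< p _ _ (begin-strict
      weight y + p    ≡⟨ shift-weight S ⟩
      weight l + q    ≡⟨ shift-weight S′ ⟨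
      weight z + p′   <⟨ +-monoʳ-< (weight z) p′<p ⟩
      weight z + p    ∎)
      where open ≤-Reasoning

    weight-<ʳ : ∀ {l y z : Partition n} {p q q′} → Shift l y p q → Shift l z p q′ → q < q′ → weight y < weight z
    weight-<ʳ {l} {y} {z} {p} {q} {q′} S S′ q<q′ = +-cancelʳ-< p _ _ (begin-strict
      weight y + p    ≡⟨ shift-weight S ⟩
      weight l + q    <⟨ +-monoʳ-< (weight l) q<q′ ⟩
      weight l + q′   ≡⟨ shift-weight S′ ⟨
      weight z + p    ∎)
      where open ≤-Reasoning

    -- Decompositions in the order of weight.

    Sorted : List (Partition n) → Set
    Sorted = AllPairs (λ x y → weight x ≤ weight y)

    -- A list holds the vertices added so far, the latest and lightest in front. Ties are ordered
    -- arbitrarily, so only strictly heavier vertices can be relied on to be present.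
    Closed : (Partition n → Set) → List (Partition n) → Set
    Closed P xs = ∀ {x v} → x ∈ xs → P v → weight x < weight v → v ∈ xs

    closed-tail : ∀ {P x xs} → Sorted (x ∷ xs) → Closed P (x ∷ xs) → Closed P xs
    closed-tail (x≤ ∷ _) closed y∈xs Pv y<v with closed (there y∈xs) Pv y<v
    ... | here refl  = contradiction (All.lookup x≤ y∈xs) (<⇒≱ y<v)
    ... | there v∈xs = v∈xs

    module _ {A B : Partition n → Set}
             (A-clique : ∀ {x y} → A x → A y → x ≢ y → x ~ y) (B-clique : ∀ {x y} → B x → B y → x ≢ y → x ~ y)
             (separated : ∀ {x y} → A x → B y → ¬ x ~ y) where

      clique-decomposable : ∀ {C : Partition n → Set} → (∀ {x y} → C x → C y → x ≢ y → x ~ y) →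
                            ∀ xs → Unique xs → (∀ {x} → x ∈ xs → C x) → ∃[ r ] Decomposable 0 xs r
      clique-decomposable clique []       _       _ = -, empty
      clique-decomposable clique (x ∷ xs) (x∉ ∷ _) C =
        -, cone (All.tabulate λ y∈ → clique (C (here refl)) (C (there y∈)) (All.lookup x∉ y∈))

      -- Any order works: each vertex is attached along a simplex inside its own clique. An empty
      -- simplex opens a new component and adds 1 to the rank, a nonempty one adds 0.
      twoCliques-decomposable : ∀ xs → Unique xs → (∀ {x} → x ∈ xs → A x ⊎ B x) → ∀ {y} → y ∈ xs → ∃[ r ] Decomposable 1 xs r
      twoCliques-decomposable (x ∷ [])      _ _ _ = -, cone []
      twoCliques-decomposable (x ∷ y ∷ xs) (_ ∷ u) AB _ =
        -, add (proj₂ (link (AB (here refl)))) (proj₂ (twoCliques-decomposable (y ∷ xs) u (AB ∘ there) (here refl)))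
        where
        link : A x ⊎ B x → ∃[ r ] Decomposable 0 (lk x (y ∷ xs)) r
        link (inj₁ Ax) = clique-decomposable A-clique _ (Unique.filter⁺ (x ~?_) u) λ z∈ → onlyA (∈-filter⁻ (x ~?_) z∈)
          where
          onlyA : ∀ {z} → z ∈ y ∷ xs × x ~ z → A z
          onlyA (z∈ , x~z) with AB (there z∈)
          ... | inj₁ Az = Az
          ... | inj₂ Bz = contradiction x~z (separated Ax Bz)
        link (inj₂ Bx) = clique-decomposable B-clique _ (Unique.filter⁺ (x ~?_) u) λ z∈ → onlyB (∈-filter⁻ (x ~?_) z∈)
          where
          onlyB : ∀ {z} → z ∈ y ∷ xs × x ~ z → B z
          onlyB (z∈ , x~z) with AB (there z∈)
          ... | inj₁ Az = contradiction (~-sym x~z) (separated Az Bx)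
          ... | inj₂ Bz = Bz

    module _ (l : Partition n) where

      link-decomposable : ∀ xs → Unique xs → Sorted xs → Closed (l ~_) xs →
                          (∀ {y} → y ∈ xs → l ~ y × weight l ≤ weight y) → ∀ {y} → y ∈ xs → ∃[ r ] Decomposable 2 xs r
      link-decomposable (y ∷ []) _ _ _ _ _ = -, cone []
      link-decomposable (y ∷ xs@(z₀ ∷ _)) u@(y∉ ∷ u′) sorted@(y≤ ∷ sorted′) closed above _ =
        -, add (proj₂ second-link)
          (proj₂ (link-decomposable xs u′ sorted′ (closed-tail sorted closed) (above ∘ there) (here refl)))
        where
        Up : Partition n → ℕ → ℕ → Set
        Up v p q = Shift l v p q × p < q
        up : ∀ {v} → v ∈ y ∷ xs → ∃[ p ] ∃[ q ] Up v p q
        up v∈ with p , q , S ← adjacent⇒shift (proj₁ (above v∈)) = p , q , S , shift-up S (proj₂ (above v∈))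
        p = proj₁ (up (here refl))
        q = proj₁ (proj₂ (up (here refl)))
        S = proj₁ (proj₂ (proj₂ (up (here refl))))
        p<q = proj₂ (proj₂ (proj₂ (up (here refl))))
        A B : Partition n → Set
        A v = ∃[ p′ ] p′ < p × Shift l v p′ q
        B v = ∃[ q′ ] q < q′ × Shift l v p q′
        A-clique : ∀ {v w} → A v → A w → v ≢ w → v ~ w
        A-clique (p₁ , _ , S₁) (p₂ , _ , S₂) v≢w =
          shift⇒adjacent (shift-target S₁ S₂ λ { refl → v≢w (shift-unique S₁ S₂) })
        B-clique : ∀ {v w} → B v → B w → v ≢ w → v ~ w
        B-clique (q₁ , _ , S₁) (q₂ , _ , S₂) v≢w =
          shift⇒adjacent (shift-source S₁ S₂ λ { refl → v≢w (shift-unique S₁ S₂) })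
        separated : ∀ {v w} → A v → B w → ¬ v ~ w
        separated (p′ , p′<p , S₁) (q′ , q<q′ , S₂) v~w
          with shifts-share S₁ (<-trans p′<p p<q) S₂ (<-trans p<q q<q′) v~w
        ... | inj₁ p′≡p = <⇒≢ p′<p p′≡p
        ... | inj₂ q≡q′ = <⇒≢ q<q′ q≡q′
        -- If `p` is shared, sortedness gives `q ≤ q′`, and equality would make `z` equal to `y`; if
        -- `q` is shared, the argument is the mirror image.
        classify : ∀ {z} → z ∈ xs → y ~ z → A z ⊎ B z
        classify z∈ y~z with p′ , q′ , S′ , p′<q′ ← up (there z∈) with shifts-share S p<q S′ p′<q′ y~z
        ... | inj₁ refl = inj₂ (q′ , ≤∧≢⇒< (+-cancelʳ-≤ p q q′ (shift-compare S S′ (All.lookup y≤ z∈)))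
                                     (λ { refl → ~-irrefl (shift-unique S S′) y~z }) , S′)
        ... | inj₂ refl = inj₁ (p′ , ≤∧≢⇒< (+-cancelˡ-≤ q p′ p (shift-compare S S′ (All.lookup y≤ z∈)))
                                     (λ { refl → ~-irrefl (shift-unique S S′) y~z }) , S′)
        enter : ∀ {w} → Adjacent l w → y ~ w → weight y < weight w → w ∈ lk y xs
        enter {w} l~w y~w y<w with closed (here refl) l~w y<w
        ... | here refl = contradiction y~w (~-irrefl refl)
        ... | there w∈  = ∈-filter⁺ (y ~?_) w∈ y~w
        z₀∈ : z₀ ∈ xs
        z₀∈ = here refl
        -- Compare `y` with the next vertex `z₀`, given by (p′ , q′). If p′ < p, the mixed shift (p′
        -- , q) is adjacent to `y` and strictly heavier, hence already in the list; if q < q′, the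
        -- same holds for (p , q′).
        neighbour : ∃[ w ] w ∈ lk y xs
        neighbour with p′ , q′ , S′ , p′<q′ ← up (there z₀∈) with p′ <? p
        ... | yes p′<p with w , T ← shift-mix S S′ (≤-<-trans p′<p p<q) =
          w , enter (shift⇒adjacent T) (shift⇒adjacent (shift-target S T (<⇒≢ p′<p ∘ sym))) (weight-<ˡ S T p′<p)
        ... | no p′≮p with q <? q′
        ...   | yes q<q′ with w , T ← shift-mix S′ S (≤-<-trans p<q q<q′) =
          w , enter (shift⇒adjacent T) (shift⇒adjacent (shift-source S T (<⇒≢ q<q′))) (weight-<ʳ S T q<q′)
        -- With p ≤ p′ and q′ ≤ q, the comparison of weights leaves only equality, so `z₀` would
        -- repeat `y`.
        ...   | no q≮q′ = contradiction y≡z₀ (All.lookup y∉ (here refl))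
          where
          compare : q + p′ ≤ q′ + p
          compare = shift-compare S S′ (All.lookup y≤ (here refl))
          p′≡p : p′ ≡ p
          p′≡p = ≤-antisym (+-cancelˡ-≤ q p′ p (≤-trans compare (+-monoˡ-≤ p (≮⇒≥ q≮q′)))) (≮⇒≥ p′≮p)
          q′≡q : q′ ≡ q
          q′≡q = ≤-antisym (≮⇒≥ q≮q′) (+-cancelʳ-≤ p q q′ (subst (λ □ → q + □ ≤ q′ + p) p′≡p compare))
          y≡z₀ : y ≡ z₀
          y≡z₀ = shift-unique S (subst₂ (Shift l z₀) p′≡p q′≡q S′)
        second-link : ∃[ r ] Decomposable 1 (lk y xs) r
        second-link = twoCliques-decomposable {A} {B} A-clique B-clique separated (lk y xs) (Unique.filter⁺ (y ~?_) u′)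
          (λ z∈ → let z∈xs , y~z = ∈-filter⁻ (y ~?_) z∈ in classify z∈xs y~z) (proj₂ neighbour)

    -- With at least two rows, a cell moves from the second row to the first. A one-row partition
    -- has no heavier neighbour, but being the only heaviest partition it cannot satisfy both
    -- hypotheses.
    ascent : ∀ {μ ν : Partition n} → μ ≢ ν → weight μ ≤ weight ν → ∃[ w ] Adjacent μ w × weight μ < weight w
    ascent {partition (a ∷ b ∷ _) (b≤a ∷ _) (_ ∷ 0<b ∷ _) _} _ _
      with w , _ , S , eq ← cells⇒shift 0<b (<⇒≢ (s≤s b≤a)) (suc zero , zero , (λ ()) , refl , refl) =
      w , shift⇒adjacent S , +-cancelʳ-< b _ _ (≤-trans (+-monoʳ-< _ (s≤s b≤a)) (≤-reflexive (sym eq)))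
    ascent {partition [] _ _ _} {partition [] _ _ _} μ≢ν _ = contradiction (parts-injective refl) μ≢ν
    ascent {partition [] _ _ refl} {partition (b ∷ _) _ (0<b ∷ _) eq} _ _ = contradiction (m+n≡0⇒m≡0 b eq) (<⇒≢ 0<b ∘ sym)
    ascent {partition (a ∷ []) _ (0<a ∷ _) eq} {partition [] _ _ refl} _ _ = contradiction (m+n≡0⇒m≡0 a eq) (<⇒≢ 0<a ∘ sym)
    ascent {partition (a ∷ []) _ _ eq} {partition (b ∷ []) _ _ eq′} μ≢ν _ =
      contradiction (parts-injective (cong (_∷ []) (+-cancelʳ-≡ 0 a b (trans eq (sym eq′))))) μ≢ν
    ascent {partition (a ∷ []) _ _ eq} {partition (b ∷ c ∷ cs) _ (0<b ∷ 0<c ∷ _) eq′} _ w≤ = contradiction w≤ (<⇒≱ (begin-strict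
      triangle b + total triangle (c ∷ cs)     ≤⟨ +-monoʳ-≤ (triangle b) (total-triangle (c ∷ cs)) ⟩
      triangle b + triangle (sum (c ∷ cs))     <⟨ triangle-+-< 0<b (≤-trans 0<c (m≤m+n c (sum cs))) ⟩
      triangle (sum (b ∷ c ∷ cs))              ≡⟨ cong triangle (trans eq′ (sym eq)) ⟩
      triangle (a + 0)                         ≡⟨ cong triangle (+-identityʳ a) ⟩
      triangle a                               ≡⟨ +-identityʳ (triangle a) ⟨
      triangle a + 0                           ∎))
      where open ≤-Reasoning

    partitions-decomposable : ∀ xs → Unique xs → Sorted xs → Closed (λ _ → ⊤) xs → ∀ {x} → x ∈ xs → ∃[ r ] Decomposable 3 xs r
    partitions-decomposable (x ∷ []) _ _ _ _ = -, cone []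
    partitions-decomposable (x ∷ xs@(y ∷ _)) (x∉ ∷ u) sorted@(x≤ ∷ sorted′) closed _ =
      -, add (proj₂ link) (proj₂ (partitions-decomposable xs u sorted′ (closed-tail sorted closed) (here refl)))
      where
      member : ∀ {v} → x ~ v → v ∈ x ∷ xs → v ∈ lk x xs
      member x~v (here refl) = contradiction x~v (~-irrefl refl)
      member x~v (there v∈)  = ∈-filter⁺ (x ~?_) v∈ x~v
      link : ∃[ r ] Decomposable 2 (lk x xs) r
      -- The presence of another vertex `y`, at least as heavy as `x`, excludes that `x` is the
      -- one-row partition, so the link is not empty.
      link with w , x~w , x<w ← ascent (All.lookup x∉ (here refl)) (All.lookup x≤ (here refl)) =
        link-decomposable x (lk x xs) (Unique.filter⁺ (x ~?_) u) (AllPairs.filter⁺ (x ~?_) sorted′)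
          (λ y∈ x~v y<v → member x~v (closed (there (proj₁ (∈-filter⁻ (x ~?_) y∈))) tt y<v))
          (λ z∈ → let z∈xs , x~z = ∈-filter⁻ (x ~?_) z∈ in x~z , All.lookup x≤ z∈xs)
          (member x~w (closed (here refl) tt x<w))

open Diagrams

open import Data.Nat.Base using (_≥_)
open import Data.Integer.Base using (+_; 1ℤ; _-_)

proposition7p2 : ∀ (n : ℕ) → n ≥ 1 →
    (∀ i → i ≢ + 2 → IsTrivial (H̃ (K n) i))
    × (Σ[ r ∈ ℕ ] ((+ r) ≡ (χ (K n) - 1ℤ) × (H̃ (K n) (+ 2) ≅ (ℤ^ r))))
proposition7p2 n n≥1 = Comparison.decomposable⇒homology (G n) xs↭ (proj₂ (partitions-decomposable xs
    (Unique-resp-↭ (setoid (Partition n)) (↭⇒↭ₛ (↭-sym xs↭)) (partitions-unique n))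
    (Linked⇒AllPairs ℕ.≤-trans (sort-↗ byWeight (partitions n)))
    (λ {_} {v} _ _ _ → complete v)
    -- The one-row partition shows that there is a vertex to start from; its single part is positive
    -- because `n ≥ 1`.
    (complete (partition (n ∷ []) [-] (n≥1 ∷ []) (ℕ.+-identityʳ n)))))
  where
  byWeight = on ℕ.≤-decTotalOrder (weight {n})
  xs = sort byWeight (partitions n)
  xs↭ = sort-↭ byWeight (partitions n)
  complete : ∀ (v : Partition n) → v ∈ xs
  complete v = ∈-resp-↭ (↭-sym xs↭) (partitions-complete v)
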